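{- Let $X,Y$ be indeterminates, $b_k=2k+X+Y$ for $k\ge0$ and $\lambda_k=(k+X)(k-1+Y)$ for $k\ge1$. Then for every $n\ge0$, \[ \mu_n(b_k,\lambda_k)=\sum_{T\in\mathrm{PT}_{n+1}}X^{\mathrm{urr}(T)-1}Y^{\mathrm{urc}(T)} . \]
   Context: For sequences $(b_k)_{k\ge0}$, $(\lambda_k)_{k\ge1}$ let $p_n$ be the monic polynomials with $p_{ -1}=0$, $p_0=1$, $p_{n+1}=(x-b_n)p_n-\lambda_np_{n-1}$; $\mu_n(b_k,\lambda_k)$ denotes $\mathcal L(x^n)$, where $\mathcal L$ is the unique linear functional on polynomials with $\mathcal L(1)=1$ and $\mathcal L(p_m)=0$ for all $m\ge1$. A permutation tableau is a filling of a Ferrers diagram (empty rows allowed) with 0's and 1's such that every column contains at least one 1, and no 0 has both a 1 above it in its column and a 1 to its left in its row. Its length is the number of rows plus the number of columns; $\mathrm{PT}_n$ is the set of permutation tableaux of length $n$. A 0 is restricted if it has a 1 above it in the same column; a row is unrestricted if it contains no restricted 0, and $\mathrm{urr}(T)$ is the number of unrestricted rows. A 0 is c-restricted if it has a 1 to its left in the same row; a column is unrestricted if it contains no c-restricted 0, and $\mathrm{urc}(T)$ is the number of unrestricted columns. -}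

module Defs where

open import Data.Nat using (ℕ; zero; suc; _∸_; _≡ᵇ_; _≤ᵇ_)
open import Data.Integer as ℤ using (ℤ; +_; 0ℤ; 1ℤ)
open import Data.Bool using (Bool; true; false; _∧_; _∨_; not; if_then_else_)
open import Data.List using (List; []; _∷_; length; upTo; concatMap; map; foldr; filterᵇ)
open import Data.Product using (_×_; _,_; proj₁; proj₂)
open import Data.Maybe using (Maybe; just; nothing)
open import Relation.Binary.PropositionalEquality using (_≡_)

-- ℤ[[X,Y]] : (formal power series, containing ℤ[X,Y]) as coefficient
-- functions; f i j = coefficient of X^i Y^j.

Poly2 : Set
Poly2 = ℕ → ℕ → ℤ

sumℤ : ℕ → (ℕ → ℤ) → ℤ
sumℤ zero    f = 0ℤ
sumℤ (suc n) f = sumℤ n f ℤ.+ f n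

0P 1P XP YP : Poly2
0P i j = 0ℤ
1P i j = if (i ≡ᵇ 0) ∧ (j ≡ᵇ 0) then 1ℤ else 0ℤ
XP i j = if (i ≡ᵇ 1) ∧ (j ≡ᵇ 0) then 1ℤ else 0ℤ
YP i j = if (i ≡ᵇ 0) ∧ (j ≡ᵇ 1) then 1ℤ else 0ℤ

constP : ℤ → Poly2
constP c i j = if (i ≡ᵇ 0) ∧ (j ≡ᵇ 0) then c else 0ℤ

monoP : ℕ → ℕ → Poly2
monoP a b i j = if (i ≡ᵇ a) ∧ (j ≡ᵇ b) then 1ℤ else 0ℤ

infixl 6 _+P_ _-P_
infixl 7 _*P_

_+P_ _-P_ _*P_ : Poly2 → Poly2 → Poly2
(f +P g) i j = f i j ℤ.+ g i j
(f -P g) i j = f i j ℤ.- g i j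
(f *P g) i j = sumℤ (suc i) (λ a → sumℤ (suc j) (λ b → f a b ℤ.* g (i ∸ a) (j ∸ b)))

-P_ : Poly2 → Poly2
(-P f) i j = ℤ.- f i j

infix 4 _≈P_
_≈P_ : Poly2 → Poly2 → Set
f ≈P g = ∀ i j → f i j ≡ g i j

sumP : ℕ → (ℕ → Poly2) → Poly2
sumP zero    f = 0P
sumP (suc n) f = sumP n f +P f n

sumListP : List Poly2 → Poly2
sumListP = foldr _+P_ 0P

bₖ : ℕ → Poly2
bₖ k = constP (+ (2 Data.Nat.* k)) +P XP +P YP

λₖ : ℕ → Poly2
λₖ k = (constP (+ k) +P XP) *P (constP (+ k ℤ.- 1ℤ) +P YP)

-- Polynomials in x over ℤ[X,Y]: coefficient functions, q j = coeff of x^j.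

UPoly : Set
UPoly = ℕ → Poly2

shiftX : UPoly → UPoly
shiftX q zero    = 0P
shiftX q (suc j) = q j

pPair : ℕ → UPoly × UPoly
pPair zero    = (λ _ → 0P) , (λ j → if j ≡ᵇ 0 then 1P else 0P)
pPair (suc n) with pPair n
... | q , r = r , (λ j → shiftX r j -P bₖ n *P r j -P λₖ n *P q j)

p : ℕ → UPoly
p n = proj₂ (pPair n)

-- Moments of the unique linear functional L with L(1) = 1, L(p_m) = 0 (m ≥ 1).
-- Since p_m is monic of degree m, L(p_m) = 0 reads
--   μ_m = - Σ_{j<m} [x^j]p_m · μ_j .
-- momentsUpTo n j = μ_j for all j ≤ n.
momentsUpTo : ℕ → ℕ → Poly2
momentsUpTo zero    j = 1P
momentsUpTo (suc n) j =
  if j ≤ᵇ n then momentsUpTo n j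
  else -P sumP (suc n) (λ i → p (suc n) i *P momentsUpTo n i)

μ : ℕ → Poly2
μ n = momentsUpTo n n

-- Permutation tableaux.
-- A filling is a list of rows (top to bottom), each row a list of
-- entries (left to right, true = 1, false = 0), rows left-justified.

Tableau : Set
Tableau = List (List Bool)

nth : {A : Set} → List A → ℕ → Maybe A
nth []       _       = nothing
nth (x ∷ xs) zero    = just x
nth (x ∷ xs) (suc n) = nth xs n

anyB allB : ℕ → (ℕ → Bool) → Bool
anyB zero    f = false
anyB (suc n) f = anyB n f ∨ f n
allB zero    f = true
allB (suc n) f = allB n f ∧ f n

countB : ℕ → (ℕ → Bool) → ℕ
countB zero    f = 0
countB (suc n) f = if f n then suc (countB n f) else countB n f

numRows numCols : Tableau → ℕ
numRows T = length T
numCols []      = 0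
numCols (r ∷ _) = length r

tabLength : Tableau → ℕ
tabLength T = numRows T Data.Nat.+ numCols T

-- Ferrers shape (English convention): row lengths weakly decreasing downward;
-- empty rows allowed.
ferrersB : Tableau → Bool
ferrersB []           = true
ferrersB (r ∷ [])     = true
ferrersB (r ∷ s ∷ rs) = (length s ≤ᵇ length r) ∧ ferrersB (s ∷ rs)

isOne isZero : Tableau → ℕ → ℕ → Bool
isOne T i j with nth T i
... | nothing = false
... | just r with nth r j
...   | just true = true
...   | _         = false
isZero T i j with nth T i
... | nothing = false
... | just r with nth r j
...   | just false = true
...   | _          = false

oneAbove oneLeft : Tableau → ℕ → ℕ → Bool
oneAbove T i j = anyB i (λ i' → isOne T i' j)
oneLeft  T i j = anyB j (λ j' → isOne T i j')

restricted : Tableau → ℕ → ℕ → Bool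
restricted T i j = isZero T i j ∧ oneAbove T i j

cRestricted : Tableau → ℕ → ℕ → Bool
cRestricted T i j = isZero T i j ∧ oneLeft T i j

isPT : Tableau → Bool
isPT T =
  ferrersB T
  ∧ allB (numCols T) (λ j → anyB (numRows T) (λ i → isOne T i j))
  ∧ allB (numRows T) (λ i → allB (numCols T) (λ j →
        not (isZero T i j ∧ oneAbove T i j ∧ oneLeft T i j)))

urr urc : Tableau → ℕ
urr T = countB (numRows T) (λ i → allB (numCols T) (λ j → not (restricted T i j)))
urc T = countB (numCols T) (λ j → allB (numRows T) (λ i → not (cRestricted T i j)))

boolLists : ℕ → List (List Bool)
boolLists zero    = [] ∷ []
boolLists (suc m) = concatMap (λ l → (false ∷ l) ∷ (true ∷ l) ∷ []) (boolLists m)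

listsOfLen : {A : Set} → ℕ → List A → List (List A)
listsOfLen zero    xs = [] ∷ []
listsOfLen (suc k) xs = concatMap (λ l → map (λ x → x ∷ l) xs) (listsOfLen k xs)

candidates : ℕ → List Tableau
candidates n = concatMap (λ k → listsOfLen k (concatMap boolLists (upTo (suc n)))) (upTo (suc n))

-- PT_n : the permutation tableaux of length n (each listed exactly once)
PT : ℕ → List Tableau
PT n = filterᵇ (λ T → isPT T ∧ (tabLength T ≡ᵇ n)) (candidates n)

ptSum : ℕ → Poly2
ptSum m = sumListP (map (λ T → monoP (urr T ∸ 1) (urc T)) (PT m))

{-# OPTIONS --safe #-}

-- Every permutation tableau arises from a single empty row by appending empty rows at the bottom
-- and inserting full columns on the left. Record an unrestricted row by R and an unrestricted
-- column by C, placed right after the row of its topmost 1. Then an empty row appends R, and a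
-- column with topmost 1 in a given R turns  u R Cᵃ v  into  u R Cᵃ⁺¹ v′,  where v′ runs over the
-- subwords of the R's of v. Let A, B be these two operators, C the operator appending C, and
-- g₀(w) = X^(#R − 1) Y^#C. From  BA = AB + B + CA  and  BC = B − C + C²  one finds functionals gₖ
-- on words, vanishing at the word R for k ≥ 1, with
--   gₖ A = (k + X) gₖ + λₖ gₖ₋₁   and   gₖ B = gₖ₊₁ + (k + Y) gₖ .
-- Adding the two gives the three-term recurrence, so gₖ = g₀ ∘ pₖ(A + B), and therefore
-- xⁿ ↦ g₀((A + B)ⁿ R) is the functional which is orthogonal to all pₖ with k ≥ 1.

module Submission where

-- The gₖ are forced. Let the rule for B define gₖ₊₁ = gₖB - (k + Y)gₖ. From BC = B - C + C² and g₀C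
-- = Y g₀ it follows that gₖC = gₖ for every k ≥ 1, and then BA = AB + B + CA gives gₖA = (k + X)
-- gₖ₋₁B for k ≥ 1. Expanding the right-hand side by the rule for B yields the rule for A; this is
-- where λₖ gets its two factors. The code goes the other way: the rules for A and C look only at
-- the last letter, so they serve as a recursive definition, and the rule for B is proved.
--
-- Words forget the restricted rows, whereas a column of a tableau has an entry in every row.
-- Tableaux are therefore tied to words through a state that lists all rows, and this works because
-- an unrestricted column never has its topmost 1 in a restricted row. A further obstacle is that
-- the tableaux of the statement are filtered from a brute-force list, in an order unrelated to the
-- insertion process; the two enumerations are matched as repetition-free lists with the same
-- members.

open import Defs
open import Data.Nat using (ℕ; suc)

open import Algebra using (CommutativeRing)
import Algebra.Properties.AbelianGroup as AbGroup
import Algebra.Properties.CommutativeSemigroup as CommSemi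
import Algebra.Properties.Ring as RingProps
import Algebra.Solver.Ring.NaturalCoefficients.Default as Solver
open import Data.Bool as 𝔹 using (Bool; true; false; _∧_; _∨_; not; if_then_else_)
import Data.Bool.Properties as 𝔹ₚ
open import Data.Empty using (⊥; ⊥-elim)
open import Data.Integer as ℤ using (ℤ; +_; 0ℤ; 1ℤ)
import Data.Integer.Properties as ℤₚ
open import Data.List using (List; []; _∷_; _∷ʳ_; _++_; map; length; zipWith; applyUpTo; foldl; foldr; concatMap; upTo)
open import Data.List.Membership.Propositional using (_∈_; find; lose)
open import Data.List.Membership.Propositional.Properties using (∈-map⁺; ∈-map⁻; ∈-++⁺ˡ; ∈-++⁺ʳ; ∈-++⁻; ∈-concatMap⁺; ∈-concatMap⁻; ∈-upTo⁺; ∈-filter⁺; ∈-filter⁻)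
open import Data.List.Membership.Propositional.Properties.WithK using (unique∧set⇒bag)
open import Data.List.Properties using (map-applyUpTo; applyUpTo-∷ʳ; foldl-∷ʳ; ∷-injective; ∷-injectiveˡ; ∷-injectiveʳ; ∷ʳ-injectiveˡ; length-++)
open import Data.List.Relation.Binary.BagAndSetEquality using (∼bag⇒↭)
open import Data.List.Relation.Binary.Permutation.Propositional as Perm using (_↭_)
open import Data.List.Relation.Unary.All as All using (All; []; _∷_)
import Data.List.Relation.Unary.All.Properties as Allₚ
open import Data.List.Relation.Unary.AllPairs using ([]; _∷_)
open import Data.List.Relation.Unary.Any using (here; there)
open import Data.List.Relation.Unary.Unique.Propositional using (Unique)
import Data.List.Relation.Unary.Unique.Propositional.Properties as Uniq
open import Data.Maybe using (Maybe; just; nothing)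
open import Data.Nat as ℕ using (zero; _∸_; _≤_; _<_; _≤ᵇ_; _≡ᵇ_; z≤n; s≤s)
import Data.Nat.Properties as ℕₚ
open import Data.Product using (_×_; _,_; proj₁; proj₂; ∃; ∃₂)
open import Data.Sum using (_⊎_; inj₁; inj₂)
open import Function using (_∘_; mk⇔; Equivalence)
open import Level using (0ℓ)
open import Relation.Binary using (tri<; tri≈; tri>)
open import Relation.Binary.PropositionalEquality as ≡ using (_≡_; _≢_; refl; cong; cong₂; subst; module ≡-Reasoning)
import Relation.Binary.Reasoning.Setoid as SetoidReasoning

-- Finite sums

module Sums (R : CommutativeRing 0ℓ 0ℓ) where
  open CommutativeRing R renaming (refl to ≈-refl)
  open CommSemi +-commutativeSemigroup using (interchange)

  Σ[_] : {A : Set} → (A → Carrier) → List A → Carrier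
  Σ[ f ] xs = foldr _+_ 0# (map f xs)

  Σ-cong : {A : Set} {f g : A → Carrier} (xs : List A) →
           (∀ {x} → x ∈ xs → f x ≈ g x) → Σ[ f ] xs ≈ Σ[ g ] xs
  Σ-cong []       p = ≈-refl
  Σ-cong (x ∷ xs) p = +-cong (p (here refl)) (Σ-cong xs (λ x∈xs → p (there x∈xs)))

  Σ-++ : {A : Set} (f : A → Carrier) (xs ys : List A) → Σ[ f ] (xs ++ ys) ≈ Σ[ f ] xs + Σ[ f ] ys
  Σ-++ f []       ys = sym (+-identityˡ _)
  Σ-++ f (x ∷ xs) ys = trans (+-congˡ (Σ-++ f xs ys)) (sym (+-assoc _ _ _))

  Σ-map : {A B : Set} (f : B → Carrier) (h : A → B) (xs : List A) →
          Σ[ f ] (map h xs) ≈ Σ[ (λ x → f (h x)) ] xs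
  Σ-map f h []       = ≈-refl
  Σ-map f h (x ∷ xs) = +-congˡ (Σ-map f h xs)

  Σ-concatMap : {A B : Set} (f : B → Carrier) (h : A → List B) (xs : List A) →
                Σ[ f ] (concatMap h xs) ≈ Σ[ (λ x → Σ[ f ] (h x)) ] xs
  Σ-concatMap f h []       = ≈-refl
  Σ-concatMap f h (x ∷ xs) =
    trans (Σ-++ f (h x) (concatMap h xs)) (+-congˡ (Σ-concatMap f h xs))

  Σ-+ : {A : Set} (f g : A → Carrier) (xs : List A) →
        Σ[ (λ x → f x + g x) ] xs ≈ Σ[ f ] xs + Σ[ g ] xs
  Σ-+ f g []       = sym (+-identityˡ _)
  Σ-+ f g (x ∷ xs) = trans (+-congˡ (Σ-+ f g xs)) (interchange _ _ _ _)

  Σ-*ˡ : {A : Set} (c : Carrier) (f : A → Carrier) (xs : List A) →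
         Σ[ (λ x → c * f x) ] xs ≈ c * Σ[ f ] xs
  Σ-*ˡ c f []       = sym (zeroʳ c)
  Σ-*ˡ c f (x ∷ xs) = trans (+-congˡ (Σ-*ˡ c f xs)) (sym (distribˡ c _ _))

  Σ-zero : {A : Set} (xs : List A) → Σ[ (λ _ → 0#) ] xs ≈ 0#
  Σ-zero []       = ≈-refl
  Σ-zero (x ∷ xs) = trans (+-identityˡ _) (Σ-zero xs)

  Σ-↭ : {A : Set} (f : A → Carrier) {xs ys : List A} → xs ↭ ys → Σ[ f ] xs ≈ Σ[ f ] ys
  Σ-↭ f Perm.refl         = ≈-refl
  Σ-↭ f (Perm.prep x p)   = +-congˡ (Σ-↭ f p)
  Σ-↭ f (Perm.swap x y p) =
    trans (sym (+-assoc _ _ _))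
      (trans (+-cong (+-comm _ _) (Σ-↭ f p)) (+-assoc _ _ _))
  Σ-↭ f (Perm.trans p q)  = trans (Σ-↭ f p) (Σ-↭ f q)

  sumTo : ℕ → (ℕ → Carrier) → Carrier
  sumTo zero    f = 0#
  sumTo (suc n) f = sumTo n f + f n

  sumTo-cong : ∀ n {f h : ℕ → Carrier} → (∀ i → i < n → f i ≈ h i) → sumTo n f ≈ sumTo n h
  sumTo-cong zero    p = ≈-refl
  sumTo-cong (suc n) p = +-cong (sumTo-cong n (λ i i<n → p i (ℕₚ.m<n⇒m<1+n i<n))) (p n ℕₚ.≤-refl)

  sumTo-peel : ∀ n f → sumTo (suc n) f ≈ f 0 + sumTo n (λ i → f (suc i))
  sumTo-peel zero    f = +-comm _ _
  sumTo-peel (suc n) f = trans (+-congʳ (sumTo-peel n f)) (+-assoc _ _ _)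

  sumTo-zero : ∀ n {f : ℕ → Carrier} → (∀ i → f i ≈ 0#) → sumTo n f ≈ 0#
  sumTo-zero zero    p = ≈-refl
  sumTo-zero (suc n) p = trans (+-cong (sumTo-zero n p) (p n)) (+-identityˡ _)

  sumTo-+ : ∀ n (f h : ℕ → Carrier) → sumTo n (λ i → f i + h i) ≈ sumTo n f + sumTo n h
  sumTo-+ zero    f h = sym (+-identityˡ _)
  sumTo-+ (suc n) f h = trans (+-congʳ (sumTo-+ n f h)) (interchange _ _ _ _)

  sumTo-*ˡ : ∀ n c (f : ℕ → Carrier) → sumTo n (λ i → c * f i) ≈ c * sumTo n f
  sumTo-*ˡ zero    c f = sym (zeroʳ c)
  sumTo-*ˡ (suc n) c f = trans (+-congʳ (sumTo-*ˡ n c f)) (sym (distribˡ c _ _))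

  sumTo-Σ : {A : Set} (n : ℕ) (f : ℕ → A → Carrier) (xs : List A) →
           sumTo n (λ i → Σ[ f i ] xs) ≈ Σ[ (λ x → sumTo n (λ i → f i x)) ] xs
  sumTo-Σ zero    f xs = sym (Σ-zero xs)
  sumTo-Σ (suc n) f xs = trans (+-congʳ (sumTo-Σ n f xs)) (sym (Σ-+ _ _ xs))

-- Power series

module Series (R : CommutativeRing 0ℓ 0ℓ) where
  open CommutativeRing R renaming (refl to ≈-refl)
  open Sums R using (sumTo; sumTo-peel)
  open SetoidReasoning setoid
  open CommSemi +-commutativeSemigroup using (interchange)

  Ser : Set
  Ser = ℕ → Carrier

  infix 4 _≋_
  _≋_ : Ser → Ser → Set
  f ≋ g = ∀ n → f n ≈ g n

  tl : Ser → Ser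
  tl f n = f (suc n)

  conv : Ser → Ser → Ser
  conv f g zero    = f 0 * g 0
  conv f g (suc n) = f 0 * g (suc n) + conv (tl f) g n

  one : Ser
  one zero    = 1#
  one (suc n) = 0#

  conv-cong : ∀ {f f′ g g′} → f ≋ f′ → g ≋ g′ → conv f g ≋ conv f′ g′
  conv-cong p q zero    = *-cong (p 0) (q 0)
  conv-cong p q (suc n) =
    +-cong (*-cong (p 0) (q (suc n))) (conv-cong (λ i → p (suc i)) q n)

  conv-zeroˡ : ∀ {f} g → (∀ n → f n ≈ 0#) → ∀ n → conv f g n ≈ 0#
  conv-zeroˡ g p zero    = trans (*-congʳ (p 0)) (zeroˡ _)
  conv-zeroˡ g p (suc n) =
    trans (+-cong (trans (*-congʳ (p 0)) (zeroˡ _)) (conv-zeroˡ g (λ i → p (suc i)) n))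
          (+-identityˡ 0#)

  conv-constˡ : ∀ {f} g → (∀ n → f (suc n) ≈ 0#) → ∀ n → conv f g n ≈ f 0 * g n
  conv-constˡ g p zero    = ≈-refl
  conv-constˡ g p (suc n) = trans (+-congˡ (conv-zeroˡ g p n)) (+-identityʳ _)

  conv-identityˡ : ∀ f → conv one f ≋ f
  conv-identityˡ f n = trans (conv-constˡ f (λ _ → ≈-refl) n) (*-identityˡ _)

  conv-distribʳ : ∀ h f g → conv (λ n → f n + g n) h ≋ (λ n → conv f h n + conv g h n)
  conv-distribʳ h f g zero    = distribʳ (h 0) (f 0) (g 0)
  conv-distribʳ h f g (suc n) =
    trans (+-cong (distribʳ (h (suc n)) (f 0) (g 0)) (conv-distribʳ h (tl f) (tl g) n))
          (interchange _ _ _ _)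

  conv-scaleˡ : ∀ c f g n → conv (λ i → c * f i) g n ≈ c * conv f g n
  conv-scaleˡ c f g zero    = *-assoc c (f 0) (g 0)
  conv-scaleˡ c f g (suc n) =
    trans (+-cong (*-assoc c (f 0) (g (suc n))) (conv-scaleˡ c (tl f) g n))
          (sym (distribˡ c _ _))

  conv-assoc : ∀ f g h → conv (conv f g) h ≋ conv f (conv g h)
  conv-assoc f g h zero    = *-assoc (f 0) (g 0) (h 0)
  conv-assoc f g h (suc n) = begin
    (f 0 * g 0) * h (suc n) + conv (tl (conv f g)) h n
      ≈⟨ +-cong (*-assoc _ _ _) (conv-distribʳ h (λ i → f 0 * tl g i) (conv (tl f) g) n) ⟩
    f 0 * (g 0 * h (suc n)) + (conv (λ i → f 0 * tl g i) h n + conv (conv (tl f) g) h n)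
      ≈⟨ +-congˡ (+-cong (conv-scaleˡ (f 0) (tl g) h n) (conv-assoc (tl f) g h n)) ⟩
    f 0 * (g 0 * h (suc n)) + (f 0 * conv (tl g) h n + conv (tl f) (conv g h) n)
      ≈⟨ sym (+-assoc _ _ _) ⟩
    (f 0 * (g 0 * h (suc n)) + f 0 * conv (tl g) h n) + conv (tl f) (conv g h) n
      ≈⟨ +-congʳ (sym (distribˡ (f 0) _ _)) ⟩
    f 0 * conv g h (suc n) + conv (tl f) (conv g h) n ∎

  -- `conv` recurses on its left factor. This is the mirror image, peeling the right factor;
  -- comparing the two forms gives commutativity by induction.
  conv-peelʳ : ∀ f g n → conv f g (suc n) ≈ g 0 * f (suc n) + conv f (tl g) n
  conv-peelʳ f g zero    = trans (+-comm _ _) (+-congʳ (*-comm _ _))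
  conv-peelʳ f g (suc n) = begin
    f 0 * g (suc (suc n)) + conv (tl f) g (suc n)
      ≈⟨ +-congˡ (conv-peelʳ (tl f) g n) ⟩
    f 0 * g (suc (suc n)) + (g 0 * f (suc (suc n)) + conv (tl f) (tl g) n)
      ≈⟨ sym (+-assoc _ _ _) ⟩
    (f 0 * g (suc (suc n)) + g 0 * f (suc (suc n))) + conv (tl f) (tl g) n
      ≈⟨ +-congʳ (+-comm _ _) ⟩
    (g 0 * f (suc (suc n)) + f 0 * g (suc (suc n))) + conv (tl f) (tl g) n
      ≈⟨ +-assoc _ _ _ ⟩
    g 0 * f (suc (suc n)) + conv f (tl g) (suc n) ∎

  conv-comm : ∀ f g → conv f g ≋ conv g f
  conv-comm f g zero    = *-comm (f 0) (g 0)
  conv-comm f g (suc n) = trans (conv-peelʳ f g n) (+-congˡ (conv-comm f (tl g) n))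

  seriesRing : CommutativeRing 0ℓ 0ℓ
  seriesRing = record
    { Carrier = Ser
    ; _≈_ = _≋_
    ; _+_ = λ f g n → f n + g n
    ; _*_ = conv
    ; -_ = λ f n → - f n
    ; 0# = λ _ → 0#
    ; 1# = one
    ; isCommutativeRing = record
      { isRing = record
        { +-isAbelianGroup = record
          { isGroup = record
            { isMonoid = record
              { isSemigroup = record
                { isMagma = record
                  { isEquivalence = record
                    { refl = λ n → ≈-refl
                    ; sym = λ p n → sym (p n)
                    ; trans = λ p q n → trans (p n) (q n) }
                  ; ∙-cong = λ p q n → +-cong (p n) (q n) }
                ; assoc = λ f g h n → +-assoc _ _ _ }
              ; identity = (λ f n → +-identityˡ _) , (λ f n → +-identityʳ _) }
            ; inverse = (λ f n → -‿inverseˡ _) , (λ f n → -‿inverseʳ _)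
            ; ⁻¹-cong = λ p n → -‿cong (p n) }
          ; comm = λ f g n → +-comm _ _ }
        ; *-cong = conv-cong
        ; *-assoc = conv-assoc
        ; *-identity = conv-identityˡ
                     , (λ f n → trans (conv-comm f one n) (conv-identityˡ f n))
        ; distrib = (λ f g h n → trans (conv-comm f _ n)
                       (trans (conv-distribʳ f g h n)
                              (+-cong (conv-comm g f n) (conv-comm h f n))))
                  , conv-distribʳ }
      ; *-comm = conv-comm } }

  conv≈sumTo : ∀ f g n → conv f g n ≈ sumTo (suc n) (λ a → f a * g (n ∸ a))
  conv≈sumTo f g zero    = sym (+-identityˡ _)
  conv≈sumTo f g (suc n) =
    trans (+-congˡ (conv≈sumTo (tl f) g n)) (sym (sumTo-peel (suc n) (λ a → f a * g (suc n ∸ a))))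

-- The coefficient ring as series in X over series in Y

module ℤ[[Y]] = Series ℤₚ.+-*-commutativeRing
module ℤ[[Y]][[X]] = Series ℤ[[Y]].seriesRing

private
  module C₂  = CommutativeRing ℤ[[Y]][[X]].seriesRing
  module ΣY  = Sums ℤₚ.+-*-commutativeRing
  module ΣYX = Sums ℤ[[Y]].seriesRing

sumℤ≡sumTo : ∀ n f → sumℤ n f ≡ ΣY.sumTo n f
sumℤ≡sumTo zero    f = refl
sumℤ≡sumTo (suc n) f = ≡.cong (ℤ._+ f n) (sumℤ≡sumTo n f)

sumTo-eval : ∀ n F j → ΣYX.sumTo n F j ≡ sumℤ n (λ a → F a j)
sumTo-eval zero    F j = refl
sumTo-eval (suc n) F j = ≡.cong (ℤ._+ F n j) (sumTo-eval n F j)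

sumℤ-cong : ∀ n {f g : ℕ → ℤ} → (∀ i → f i ≡ g i) → sumℤ n f ≡ sumℤ n g
sumℤ-cong zero    p = refl
sumℤ-cong (suc n) p = ≡.cong₂ ℤ._+_ (sumℤ-cong n p) (p n)

-- A `Poly2` is a series in X with coefficients in ℤ[[Y]], and the double sum in `_*P_` is the
-- iterated convolution. The ring laws of `poly2Ring` are transported along this identity.
conv≈*P : ∀ f g → ℤ[[Y]][[X]].conv f g ≈P f *P g
conv≈*P f g i j = ≡.trans (ℤ[[Y]][[X]].conv≈sumTo f g i j)
  (≡.trans (sumTo-eval (suc i) _ j)
    (sumℤ-cong (suc i) λ a → ≡.trans (ℤ[[Y]].conv≈sumTo (f a) (g (i ∸ a)) j)
                                     (≡.sym (sumℤ≡sumTo (suc j) _))))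

1P≈one : 1P ≈P ℤ[[Y]][[X]].one
1P≈one zero    zero    = refl
1P≈one zero    (suc j) = refl
1P≈one (suc i) j       = refl

*P-via : ∀ {f f′ g g′} → f ≈P f′ → g ≈P g′ → f *P g ≈P ℤ[[Y]][[X]].conv f′ g′
*P-via {f} {f′} {g} {g′} p q =
  C₂.trans {f *P g} {ℤ[[Y]][[X]].conv f g} {ℤ[[Y]][[X]].conv f′ g′}
    (C₂.sym {ℤ[[Y]][[X]].conv f g} {f *P g} (conv≈*P f g))
    (ℤ[[Y]][[X]].conv-cong {f} {f′} {g} {g′} p q)

*P-conv : ∀ f g → f *P g ≈P ℤ[[Y]][[X]].conv f g
*P-conv f g i j = ≡.sym (conv≈*P f g i j)

-- The record keeps _≈P_ from unfolding to a Π-type, so that its two sides can be inferred.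
infix 4 _≃_
record _≃_ (f g : Poly2) : Set where
  constructor mk≃
  field coeff : f ≈P g
open _≃_ public

poly2Ring : CommutativeRing 0ℓ 0ℓ
poly2Ring = record
  { Carrier = Poly2
  ; _≈_ = _≃_
  ; _+_ = _+P_
  ; _*_ = _*P_
  ; -_ = -P_
  ; 0# = 0P
  ; 1# = 1P
  ; isCommutativeRing = record
    { isRing = record
      { +-isAbelianGroup = record
        { isGroup = record
          { isMonoid = record
            { isSemigroup = record
              { isMagma = record
                { isEquivalence = record
                  { refl = mk≃ λ i j → refl
                  ; sym = λ p → mk≃ λ i j → ≡.sym (coeff p i j)
                  ; trans = λ p q → mk≃ λ i j → ≡.trans (coeff p i j) (coeff q i j) }
                ; ∙-cong = λ p q → mk≃ λ i j → ≡.cong₂ ℤ._+_ (coeff p i j) (coeff q i j) }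
              ; assoc = λ f g h → mk≃ (C₂.+-assoc f g h) }
            ; identity = (λ f → mk≃ (C₂.+-identityˡ f)) , (λ f → mk≃ (C₂.+-identityʳ f)) }
          ; inverse = (λ f → mk≃ (C₂.-‿inverseˡ f)) , (λ f → mk≃ (C₂.-‿inverseʳ f))
          ; ⁻¹-cong = λ p → mk≃ λ i j → ≡.cong ℤ.-_ (coeff p i j) }
        ; comm = λ f g → mk≃ (C₂.+-comm f g) }
      ; *-cong = λ {f} {f′} {g} {g′} p q → mk≃ λ i j →
          ≡.trans (*P-via {f} {f′} {g} {g′} (coeff p) (coeff q) i j) (conv≈*P f′ g′ i j)
      ; *-assoc = λ f g h → mk≃ λ i j →
          ≡.trans (*P-via {f *P g} {_} {h} {h} (*P-conv f g) (λ _ _ → refl) i j)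
            (≡.trans (C₂.*-assoc f g h i j)
              (≡.sym (*P-via {f} {f} {g *P h} {_} (λ _ _ → refl) (*P-conv g h) i j)))
      ; *-identity =
          (λ f → mk≃ λ i j → ≡.trans (*P-via {1P} {_} {f} {f} 1P≈one (λ _ _ → refl) i j)
                             (C₂.*-identityˡ f i j))
        , (λ f → mk≃ λ i j → ≡.trans (*P-via {f} {f} {1P} {_} (λ _ _ → refl) 1P≈one i j)
                             (C₂.*-identityʳ f i j))
      ; distrib =
          (λ f g h → mk≃ λ i j → ≡.trans (*P-conv f (g +P h) i j)
             (≡.trans (C₂.distribˡ f g h i j)
                      (≡.cong₂ ℤ._+_ (conv≈*P f g i j) (conv≈*P f h i j))))
        , (λ f g h → mk≃ λ i j → ≡.trans (*P-conv (g +P h) f i j)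
             (≡.trans (C₂.distribʳ f g h i j)
                      (≡.cong₂ ℤ._+_ (conv≈*P g f i j) (conv≈*P h f i j)))) }
    ; *-comm = λ f g → mk≃ λ i j → ≡.trans (*P-conv f g i j)
        (≡.trans (C₂.*-comm f g i j) (conv≈*P g f i j)) } }

XP*mono : ∀ a b → XP *P monoP a b ≈P monoP (suc a) b
XP*mono a b zero    j = ≡.trans (*P-conv XP (monoP a b) 0 j)
  (ℤ[[Y]].conv-zeroˡ (monoP a b 0) (λ _ → refl) j)
XP*mono a b (suc i) j = ≡.trans (*P-conv XP (monoP a b) (suc i) j)
  (≡.trans (≡.cong₂ ℤ._+_
             (ℤ[[Y]].conv-zeroˡ (monoP a b (suc i)) (λ _ → refl) j)
             (ℤ[[Y]][[X]].conv-cong {_} {_} {monoP a b} {monoP a b} (X′≈one) (λ _ _ → refl) i j))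
    (≡.trans (ℤₚ.+-identityˡ _) (ℤ[[Y]][[X]].conv-identityˡ (monoP a b) i j)))
  where
  X′≈one : ∀ i j → XP (suc i) j ≡ ℤ[[Y]][[X]].one i j
  X′≈one zero    zero    = refl
  X′≈one zero    (suc j) = refl
  X′≈one (suc i) j       = refl

YP*mono : ∀ a b → YP *P monoP a b ≈P monoP a (suc b)
YP*mono a b i j = ≡.trans (*P-conv YP (monoP a b) i j)
  (≡.trans (ℤ[[Y]][[X]].conv-constˡ {YP} (monoP a b) (λ _ _ → refl) i j) (shift j))
  where
  ∧-false : ∀ x → 0ℤ ≡ (if x ∧ false then 1ℤ else 0ℤ)
  ∧-false true  = refl
  ∧-false false = refl
  Y′≈one : ∀ j → YP 0 (suc j) ≡ ℤ[[Y]].one j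
  Y′≈one zero    = refl
  Y′≈one (suc j) = refl
  shift : ∀ j → ℤ[[Y]].conv (YP 0) (monoP a b i) j ≡ monoP a (suc b) i j
  shift zero    = ∧-false (i ≡ᵇ a)
  shift (suc j) = ≡.trans (ℤₚ.+-identityˡ _)
    (≡.trans (ℤ[[Y]].conv-cong {_} {_} {monoP a b i} Y′≈one (λ _ → refl) j)
             (ℤ[[Y]].conv-identityˡ (monoP a b i) j))

-- The functionals gₖ on words

data Word : Set where
  R₀      : Word
  _▷R _▷C : Word → Word

mutual
  -- `ins` is B and `ins⁻` is B - C, the insertions whose topmost 1 is not in the last R. With C
  -- split off, the relations for BA and BC involve no subtraction: they are the last two clauses of
  -- `ins⁻`. The letter `R₀` stands for the top row, which is never deleted.
  ins : Word → List Word
  ins w = (w ▷C) ∷ ins⁻ w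

  ins⁻ : Word → List Word
  ins⁻ R₀     = []
  ins⁻ (w ▷R) = ins w ++ map _▷R (ins w)
  ins⁻ (w ▷C) = ins⁻ w

step : Word → List Word
step w = (w ▷R) ∷ ins w

module Moments (R : CommutativeRing 0ℓ 0ℓ) (x y : CommutativeRing.Carrier R) where
  open CommutativeRing R renaming (refl to ≈-refl)
  open Sums R
  open AbGroup +-abelianGroup using (inverseʳ-unique)
  open RingProps ring using (-0#≈0#)
  open SetoidReasoning setoid
  open Solver commutativeSemiring using (solve; _:=_; _:+_; _:*_; con)

  α β : ℕ → Carrier
  α zero    = x
  α (suc k) = 1# + α k
  β zero    = y
  β (suc k) = 1# + β k

  b lam : ℕ → Carrier
  b k = α k + β k
  lam zero    = 0#
  lam (suc k) = α (suc k) * β k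

  g : ℕ → Word → Carrier
  g zero    R₀     = 1#
  g (suc k) R₀     = 0#
  g zero    (w ▷R) = x * g 0 w
  g (suc k) (w ▷R) = α (suc k) * g (suc k) w + α (suc k) * β k * g k w
  g zero    (w ▷C) = y * g 0 w
  g (suc k) (w ▷C) = g (suc k) w

  mutual
    -- The insertion `w ▷C` contributes y g₀ if k = 0, but gₖ itself if k ≥ 1. Hence the remaining
    -- insertions give g₁ alone for k = 0, while for k ≥ 1 the coefficient of gₖ drops by one, from
    -- `β k` to `β (k − 1)`. This is why `ins⁻` needs two lemmas.
    Σg-ins : ∀ k w → Σ[ g k ] (ins w) ≈ g (suc k) w + β k * g k w
    Σg-ins zero    w = trans (+-congˡ (Σg-ins⁻-zero w)) (+-comm _ _)
    Σg-ins (suc k) w = trans (+-congˡ (Σg-ins⁻-suc k w))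
      (solve 3 (λ b x z → x :+ (z :+ b :* x) := z :+ (con 1 :+ b) :* x) ≈-refl (β k) (g (suc k) w) (g (suc (suc k)) w))

    Σg-ins⁻-zero : ∀ w → Σ[ g 0 ] (ins⁻ w) ≈ g 1 w
    Σg-ins⁻-zero R₀     = ≈-refl
    Σg-ins⁻-zero (w ▷C) = Σg-ins⁻-zero w
    Σg-ins⁻-zero (w ▷R) = begin
      Σ[ g 0 ] (ins w ++ map _▷R (ins w))
        ≈⟨ trans (Σ-++ (g 0) (ins w) _) (+-congˡ (Σ-map (g 0) _▷R (ins w))) ⟩
      Σ[ g 0 ] (ins w) + Σ[ (λ v → x * g 0 v) ] (ins w)
        ≈⟨ +-congˡ (Σ-*ˡ x (g 0) (ins w)) ⟩
      Σ[ g 0 ] (ins w) + x * Σ[ g 0 ] (ins w)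
        ≈⟨ +-cong (Σg-ins 0 w) (*-congˡ {x} (Σg-ins 0 w)) ⟩
      (g 1 w + y * g 0 w) + x * (g 1 w + y * g 0 w)
        ≈⟨ solve 4 (λ x y a b → (b :+ y :* a) :+ x :* (b :+ y :* a)
                     := (con 1 :+ x) :* b :+ (con 1 :+ x) :* y :* a) ≈-refl x y (g 0 w) (g 1 w) ⟩
      g 1 (w ▷R) ∎

    Σg-ins⁻-suc : ∀ k w → Σ[ g (suc k) ] (ins⁻ w) ≈ g (suc (suc k)) w + β k * g (suc k) w
    Σg-ins⁻-suc k R₀     = sym (trans (+-identityˡ _) (zeroʳ (β k)))
    Σg-ins⁻-suc k (w ▷C) = Σg-ins⁻-suc k w
    Σg-ins⁻-suc k (w ▷R) = begin
      Σ[ g (suc k) ] (ins w ++ map _▷R (ins w))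
        ≈⟨ trans (Σ-++ (g (suc k)) (ins w) _) (+-congˡ (Σ-map (g (suc k)) _▷R (ins w))) ⟩
      Σ[ g (suc k) ] (ins w) + Σ[ (λ v → α (suc k) * g (suc k) v + α (suc k) * β k * g k v) ] (ins w)
        ≈⟨ +-congˡ (trans (Σ-+ _ _ (ins w))
             (+-cong (Σ-*ˡ (α (suc k)) (g (suc k)) (ins w)) (Σ-*ˡ (α (suc k) * β k) (g k) (ins w)))) ⟩
      Σ[ g (suc k) ] (ins w)
        + (α (suc k) * Σ[ g (suc k) ] (ins w) + α (suc k) * β k * Σ[ g k ] (ins w))
        ≈⟨ +-cong (Σg-ins (suc k) w)
             (+-cong (*-congˡ {α (suc k)} (Σg-ins (suc k) w)) (*-congˡ {α (suc k) * β k} (Σg-ins k w))) ⟩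
      (g (suc (suc k)) w + β (suc k) * g (suc k) w)
        + (α (suc k) * (g (suc (suc k)) w + β (suc k) * g (suc k) w)
            + α (suc k) * β k * (g (suc k) w + β k * g k w))
        ≈⟨ solve 5 (λ a b u v z →
             (z :+ (con 1 :+ b) :* v)
               :+ (a :* (z :+ (con 1 :+ b) :* v) :+ a :* b :* (v :+ b :* u))
             := ((con 1 :+ a) :* z :+ (con 1 :+ a) :* (con 1 :+ b) :* v)
               :+ b :* (a :* v :+ a :* b :* u))
             ≈-refl (α (suc k)) (β k) (g k w) (g (suc k) w) (g (suc (suc k)) w) ⟩
      g (suc (suc k)) (w ▷R) + β k * g (suc k) (w ▷R) ∎

  -- g with index shifted by one, so that the value at 0 plays the role of g₋₁ = 0.
  g₋ : ℕ → Word → Carrier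
  g₋ zero    w = 0#
  g₋ (suc k) w = g k w

  Σg-step : ∀ k w → Σ[ g k ] (step w) ≈ g (suc k) w + b k * g k w + lam k * g₋ k w
  Σg-step zero w = begin
    x * g 0 w + Σ[ g 0 ] (ins w)           ≈⟨ +-congˡ (Σg-ins 0 w) ⟩
    x * g 0 w + (g 1 w + y * g 0 w)
      ≈⟨ solve 4 (λ x y u v → x :* u :+ (v :+ y :* u) := v :+ (x :+ y) :* u) ≈-refl x y (g 0 w) (g 1 w) ⟩
    g 1 w + b 0 * g 0 w
      ≈⟨ sym (trans (+-congˡ (zeroʳ _)) (+-identityʳ _)) ⟩
    g 1 w + b 0 * g 0 w + lam 0 * 0# ∎
  Σg-step (suc k) w = begin
    g (suc k) (w ▷R) + Σ[ g (suc k) ] (ins w)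
      ≈⟨ +-congˡ (Σg-ins (suc k) w) ⟩
    g (suc k) (w ▷R) + (g (suc (suc k)) w + β (suc k) * g (suc k) w)
      ≈⟨ solve 6 (λ a b b′ u v z → (a :* v :+ a :* b :* u) :+ (z :+ b′ :* v)
            := z :+ (a :+ b′) :* v :+ a :* b :* u)
           ≈-refl (α (suc k)) (β k) (β (suc k)) (g k w) (g (suc k) w) (g (suc (suc k)) w) ⟩
    g (suc (suc k)) w + b (suc k) * g (suc k) w + lam (suc k) * g k w ∎

  -- Walks and the moment functional

  walk : ℕ → Word → Carrier
  walk zero    w = g 0 w
  walk (suc n) w = Σ[ walk n ] (step w)

  shift : (ℕ → Carrier) → ℕ → Carrier
  shift q zero    = 0#
  shift q (suc j) = q j

  pol pol₋ : ℕ → ℕ → Carrier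
  pol zero    zero    = 1#
  pol zero    (suc j) = 0#
  pol (suc k) j       = shift (pol k) j - b k * pol k j - lam k * pol₋ k j
  pol₋ zero    j = 0#
  pol₋ (suc k) j = pol k j

  -- The functional x^i ↦ walk i w, truncated to degree < N.
  eval : Word → ℕ → (ℕ → Carrier) → Carrier
  eval w N q = sumTo N (λ i → q i * walk i w)

  -- A walk of length i + 1 from w is one step followed by a walk of length i. So multiplication by
  -- x acts on the functional as A + B acts on the starting word.
  eval-shift : ∀ w N q → eval w (suc N) (shift q) ≈ Σ[ (λ v → eval v N q) ] (step w)
  eval-shift w N q = begin
    eval w (suc N) (shift q)
      ≈⟨ sumTo-peel N _ ⟩
    0# * walk 0 w + sumTo N (λ i → q i * Σ[ walk i ] (step w))
      ≈⟨ +-cong (zeroˡ _) (sumTo-cong N (λ i _ → sym (Σ-*ˡ (q i) (walk i) (step w)))) ⟩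
    0# + sumTo N (λ i → Σ[ (λ v → q i * walk i v) ] (step w))
      ≈⟨ +-identityˡ _ ⟩
    sumTo N (λ i → Σ[ (λ v → q i * walk i v) ] (step w))
      ≈⟨ sumTo-Σ N (λ i v → q i * walk i v) (step w) ⟩
    Σ[ (λ v → eval v N q) ] (step w) ∎

  eval-scale : ∀ w N c q → eval w N (λ j → c * q j) ≈ c * eval w N q
  eval-scale w N c q =
    trans (sumTo-cong N (λ i _ → *-assoc _ _ _)) (sumTo-*ˡ N c _)

  eval-+ : ∀ w N q r → eval w N (λ j → q j + r j) ≈ eval w N q + eval w N r
  eval-+ w N q r = trans (sumTo-cong N (λ i _ → distribʳ _ _ _)) (sumTo-+ N _ _)

  eval-neg : ∀ w N q → eval w N (λ j → - q j) ≈ - eval w N q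
  eval-neg w N q = inverseʳ-unique _ _ (begin
    eval w N q + eval w N (λ j → - q j)   ≈⟨ sym (eval-+ w N q (λ j → - q j)) ⟩
    eval w N (λ j → q j + - q j)
      ≈⟨ sumTo-zero N (λ i → trans (*-congʳ (-‿inverseʳ (q i))) (zeroˡ _)) ⟩
    0# ∎)

  mutual
    -- This is gₖ = g₀ ∘ pₖ(A + B): `Σg-step` has exactly the coefficients of the recurrence of
    -- `pol`, so all terms except gₖ₊₁ cancel. The word is arbitrary because `eval-shift` moves from
    -- w to the words of `step w`; the truncation N drops along with the shift and stays above the
    -- degree.
    eval-pol : ∀ k N w → k < N → eval w N (pol k) ≈ g k w
    eval-pol zero (suc N) w _ = begin
      eval w (suc N) (pol 0)                                  ≈⟨ sumTo-peel N _ ⟩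
      1# * g 0 w + sumTo N (λ i → 0# * walk (suc i) w)
        ≈⟨ +-cong (*-identityˡ _) (sumTo-zero N (λ i → zeroˡ _)) ⟩
      g 0 w + 0#                                           ≈⟨ +-identityʳ _ ⟩
      g 0 w ∎
    eval-pol (suc k) (suc N) w (s≤s k<N) = begin
      eval w (suc N) (pol (suc k))
        ≈⟨ trans (eval-+ w (suc N) _ _) (+-cong (eval-+ w (suc N) _ _) (eval-neg w (suc N) _)) ⟩
      eval w (suc N) (shift (pol k)) + eval w (suc N) (λ j → - (b k * pol k j))
        - eval w (suc N) (λ j → lam k * pol₋ k j)
        ≈⟨ +-cong (+-cong (eval-shift w N (pol k))
             (trans (eval-neg w (suc N) _) (-‿cong (eval-scale w (suc N) (b k) (pol k)))))
             (-‿cong (eval-scale w (suc N) (lam k) (pol₋ k))) ⟩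
      Σ[ (λ v → eval v N (pol k)) ] (step w) - b k * eval w (suc N) (pol k)
        - lam k * eval w (suc N) (pol₋ k)
        ≈⟨ +-cong (+-cong (Σ-cong (step w) (λ {v} _ → eval-pol k N v k<N))
             (-‿cong (*-congˡ (eval-pol k (suc N) w (ℕₚ.m<n⇒m<1+n k<N)))))
             (-‿cong (*-congˡ (eval-pol₋ k (suc N) w (ℕₚ.m<n⇒m<1+n k<N)))) ⟩
      Σ[ g k ] (step w) - b k * g k w - lam k * g₋ k w
        ≈⟨ +-congʳ (+-congʳ (Σg-step k w)) ⟩
      g (suc k) w + b k * g k w + lam k * g₋ k w - b k * g k w - lam k * g₋ k w
        ≈⟨ cancel _ _ _ ⟩
      g (suc k) w ∎
      where
      cancel : ∀ a b c → a + b + c - b - c ≈ a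
      cancel a b c = begin
        a + b + c - b - c         ≈⟨ +-congʳ (+-congʳ (trans (+-assoc _ _ _) (trans (+-congˡ (+-comm _ _)) (sym (+-assoc _ _ _))))) ⟩
        a + c + b - b - c         ≈⟨ +-congʳ (trans (+-assoc _ _ _) (trans (+-congˡ (-‿inverseʳ b)) (+-identityʳ _))) ⟩
        a + c - c                   ≈⟨ trans (+-assoc _ _ _) (trans (+-congˡ (-‿inverseʳ c)) (+-identityʳ _)) ⟩
        a ∎

    eval-pol₋ : ∀ k N w → k < N → eval w N (pol₋ k) ≈ g₋ k w
    eval-pol₋ zero    N w _   = sumTo-zero N (λ i → zeroˡ _)
    eval-pol₋ (suc k) N w k<N = eval-pol k N w (ℕₚ.<-trans (ℕₚ.n<1+n k) k<N)

  mutual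
    pol-degree : ∀ k j → k < j → pol k j ≈ 0#
    pol-degree zero    (suc j) _         = ≈-refl
    pol-degree (suc k) (suc j) (s≤s k<j) = pol-suc k j (pol-degree k j k<j) (ℕₚ.<⇒≤ k<j)

    pol₋-degree : ∀ k j → k ≤ j → pol₋ k j ≈ 0#
    pol₋-degree zero    j _   = ≈-refl
    pol₋-degree (suc k) j k<j = pol-degree k j k<j

    -- From degree k on, the other two terms of the recurrence vanish one place higher, so the
    -- coefficient is just shifted. The value c = 0 gives the degree bound and c = 1 gives monicity.
    pol-suc : ∀ k j {c} → pol k j ≈ c → k ≤ j → pol (suc k) (suc j) ≈ c
    pol-suc k j {c} q k≤j = begin
      pol k j - b k * pol k (suc j) - lam k * pol₋ k (suc j)
        ≈⟨ +-cong (+-cong q (trans (-‿cong (trans (*-congˡ (pol-degree k (suc j) (s≤s k≤j))) (zeroʳ _))) -0#≈0#))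
             (trans (-‿cong (trans (*-congˡ (pol₋-degree k (suc j) (ℕₚ.m≤n⇒m≤1+n k≤j))) (zeroʳ _))) -0#≈0#) ⟩
      c + 0# + 0#   ≈⟨ trans (+-identityʳ _) (+-identityʳ _) ⟩
      c ∎

  pol-monic : ∀ k → pol k k ≈ 1#
  pol-monic zero    = ≈-refl
  pol-monic (suc k) = pol-suc k k (pol-monic k) ℕₚ.≤-refl


  -- Since `pol (suc n)` is monic, its annihilation determines the moment of order n + 1 from the
  -- earlier ones. The numbers `walk n R₀` obey the same condition, because their functional sends
  -- `pol k` to gₖ(R₀), which is 0 for k ≥ 1.
  moments-unique : (m : ℕ → Carrier) → m 0 ≈ 1# →
    (∀ n → m (suc n) ≈ - sumTo (suc n) (λ i → pol (suc n) i * m i)) →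
    ∀ n → m n ≈ walk n R₀
  moments-unique m m₀ m₊ n = all≤ n n ℕₚ.≤-refl
    where
    all≤ : ∀ n j → j ≤ n → m j ≈ walk j R₀
    all≤ zero    .0 z≤n = m₀
    all≤ (suc n) j j≤1+n with ℕₚ.m≤n⇒m<n∨m≡n j≤1+n
    ... | inj₁ (s≤s j≤n) = all≤ n j j≤n
    ... | inj₂ refl      = trans (m₊ n) (sym (inverseʳ-unique _ _ (begin
      sumTo (suc n) (λ i → pol (suc n) i * m i) + walk (suc n) R₀
        ≈⟨ +-cong (sumTo-cong (suc n) (λ { i (s≤s i≤n) → *-congˡ (all≤ n i i≤n) }))
             (sym (trans (*-congʳ (pol-monic (suc n))) (*-identityˡ _))) ⟩
      eval R₀ (suc (suc n)) (pol (suc n))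
        ≈⟨ eval-pol (suc n) (suc (suc n)) R₀ ℕₚ.≤-refl ⟩
      0# ∎)))

-- The moments μ

private
  module P  = CommutativeRing poly2Ring
  module M  = Moments poly2Ring XP YP
  module ΣP = Sums poly2Ring

constP-+ : ∀ a b → constP (a ℤ.+ b) ≃ constP a +P constP b
constP-+ a b = mk≃ λ where
  zero    zero    → refl
  zero    (suc j) → refl
  (suc i) j       → refl

constP-zero : constP 0ℤ ≃ 0P
constP-zero = mk≃ λ where
  zero    zero    → refl
  zero    (suc j) → refl
  (suc i) j       → refl

constP-zero+ : ∀ f → constP 0ℤ +P f ≃ f
constP-zero+ f = P.trans {_} {0P +P f} (P.+-congʳ {f} {constP 0ℤ} {0P} constP-zero) (P.+-identityˡ f)

constP-suc+ : ∀ k f → constP (+ suc k) +P f ≃ 1P +P (constP (+ k) +P f)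
constP-suc+ k f = P.trans {_} {1P +P constP (+ k) +P f}
  (P.+-congʳ {f} {constP (+ suc k)} {1P +P constP (+ k)} (constP-+ 1ℤ (+ k)))
  (P.+-assoc 1P (constP (+ k)) f)

α≃ : ∀ k → constP (+ k) +P XP ≃ M.α k
α≃ zero    = constP-zero+ XP
α≃ (suc k) = P.trans {_} {1P +P (constP (+ k) +P XP)} (constP-suc+ k XP)
  (P.+-congˡ {1P} {constP (+ k) +P XP} {M.α k} (α≃ k))

β≃ : ∀ k → constP (+ k) +P YP ≃ M.β k
β≃ zero    = constP-zero+ YP
β≃ (suc k) = P.trans {_} {1P +P (constP (+ k) +P YP)} (constP-suc+ k YP)
  (P.+-congˡ {1P} {constP (+ k) +P YP} {M.β k} (β≃ k))

bₖ≃ : ∀ k → bₖ k ≃ M.b k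
bₖ≃ k = mk≃ λ i j → ≡.trans (coeff split i j)
  (≡.cong₂ ℤ._+_ (coeff (α≃ k) i j) (coeff (β≃ k) i j))
  where
  open SetoidReasoning P.setoid
  K = constP (+ k)
  split : bₖ k ≃ (K +P XP) +P (K +P YP)
  split = begin
    constP (+ (k ℕ.+ (k ℕ.+ 0))) +P XP +P YP
      ≡⟨ ≡.cong (λ m → constP (+ (k ℕ.+ m)) +P XP +P YP) (ℕₚ.+-identityʳ k) ⟩
    constP (+ k ℤ.+ + k) +P XP +P YP
      ≈⟨ mk≃ (λ i j → ≡.cong (λ z → z ℤ.+ XP i j ℤ.+ YP i j) (coeff (constP-+ (+ k) (+ k)) i j)) ⟩
    K +P K +P XP +P YP
      ≈⟨ P.+-assoc (K +P K) XP YP ⟩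
    K +P K +P (XP +P YP)
      ≈⟨ CommSemi.interchange P.+-commutativeSemigroup K K XP YP ⟩
    (K +P XP) +P (K +P YP) ∎

λₖ≃ : ∀ k → λₖ (suc k) ≃ M.lam (suc k)
λₖ≃ k = P.*-cong {constP (+ suc k) +P XP} {M.α (suc k)} {constP (+ k) +P YP} {M.β k} (α≃ (suc k)) (β≃ k)

p₋ : ℕ → UPoly
p₋ n = proj₁ (pPair n)

-- The value λₖ 0 = X(Y − 1) differs from lam 0 = 0, but it multiplies p₋ 0 = 0.
λp₋≃ : ∀ k j → p₋ k j ≃ M.pol₋ k j → λₖ k *P p₋ k j ≃ M.lam k *P M.pol₋ k j
λp₋≃ zero    j _ = P.trans {_} {0P} (P.zeroʳ (λₖ 0)) (P.sym {_} {0P} (P.zeroʳ (M.lam 0)))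
λp₋≃ (suc k) j q = P.*-cong {λₖ (suc k)} {M.lam (suc k)} {p k j} {M.pol k j} (λₖ≃ k) q

p≃pol : ∀ k j → p k j ≃ M.pol k j
p₋≃pol₋ : ∀ k j → p₋ k j ≃ M.pol₋ k j

p≃pol zero    zero    = P.refl {1P}
p≃pol zero    (suc j) = P.refl {0P}
p≃pol (suc k) j       = mk≃ λ a c →
  ≡.cong₂ ℤ._-_
    (≡.cong₂ ℤ._-_ (coeff (shift≃ j) a c)
      (coeff (P.*-cong {bₖ k} {M.b k} {p k j} {M.pol k j} (bₖ≃ k) (p≃pol k j)) a c))
    (coeff (λp₋≃ k j (p₋≃pol₋ k j)) a c)
  where
  shift≃ : ∀ j → shiftX (p k) j ≃ M.shift (M.pol k) j
  shift≃ zero    = P.refl {0P}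
  shift≃ (suc j) = p≃pol k j

p₋≃pol₋ zero    j = P.refl {0P}
p₋≃pol₋ (suc k) j = p≃pol k j

≤ᵇ-true : ∀ {m n} → m ≤ n → (m ≤ᵇ n) ≡ true
≤ᵇ-true {m} {n} m≤n with m ≤ᵇ n | ℕₚ.≤⇒≤ᵇ m≤n
... | true | _ = refl

<ᵇ-irrefl : ∀ n → (n ℕ.<ᵇ n) ≡ false
<ᵇ-irrefl zero    = refl
<ᵇ-irrefl (suc n) = <ᵇ-irrefl n

momentsUpTo≡μ : ∀ n j → j ≤ n → momentsUpTo n j ≡ μ j
momentsUpTo≡μ zero    .0 z≤n = refl
momentsUpTo≡μ (suc n) j j≤1+n with ℕₚ.m≤n⇒m<n∨m≡n j≤1+n
... | inj₁ (s≤s j≤n) rewrite ≤ᵇ-true j≤n = momentsUpTo≡μ n j j≤n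
... | inj₂ refl = refl

sumP≃sumTo : ∀ n {f h : ℕ → Poly2} → (∀ i → i < n → f i ≃ h i) → sumP n f ≃ ΣP.sumTo n h
sumP≃sumTo zero    q = P.refl {0P}
sumP≃sumTo (suc n) {f} {h} q = P.+-cong {sumP n f} {ΣP.sumTo n h} {f n} {h n}
  (sumP≃sumTo n (λ i i<n → q i (ℕₚ.m<n⇒m<1+n i<n))) (q n ℕₚ.≤-refl)

μ-suc : ∀ n → μ (suc n) ≃ -P ΣP.sumTo (suc n) (λ i → M.pol (suc n) i *P μ i)
-- The test `suc n ≤ᵇ n` in `momentsUpTo (suc n) (suc n)` computes to `n <ᵇ n`; its failure selects
-- the new moment.
μ-suc n rewrite <ᵇ-irrefl n = P.-‿cong {sumP (suc n) (λ i → p (suc n) i *P momentsUpTo n i)}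
  {ΣP.sumTo (suc n) (λ i → M.pol (suc n) i *P μ i)}
  (sumP≃sumTo (suc n) λ { i (s≤s i≤n) →
    P.*-cong {p (suc n) i} {M.pol (suc n) i} {momentsUpTo n i} {μ i}
      (p≃pol (suc n) i) (P.reflexive (momentsUpTo≡μ n i i≤n)) })

μ≃walk : ∀ n → μ n ≃ M.walk n R₀
μ≃walk = M.moments-unique μ (P.refl {1P}) μ-suc

-- Words of tableaux

-- One pair per row of a tableau, from top to bottom: whether the row is unrestricted, and the
-- number of unrestricted columns whose topmost 1 lies in it.
State : Set
State = List (Bool × ℕ)

infixl 5 _▷C^_
_▷C^_ : Word → ℕ → Word
w ▷C^ zero  = w
w ▷C^ suc c = (w ▷C^ c) ▷C

addRow : Word → Bool × ℕ → Word
addRow w (true  , c) = (w ▷R) ▷C^ c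
addRow w (false , c) = w ▷C^ c

-- The flag of the first row is not inspected: the top row is always unrestricted and becomes `R₀`.
toWord : State → Word
toWord []            = R₀
toWord ((_ , c) ∷ s) = foldl addRow (R₀ ▷C^ c) s

below : List Bool → State
below = map (_, 0)

-- The effect of a new first column, by the position of its topmost 1. A row below it stays
-- unrestricted iff it receives a 1, and a column whose topmost 1 lies in such a row becomes
-- restricted, because the row of the new topmost 1 puts a 1 to the left of one of its zeros.
insertCol : List Bool → State → State
insertCol (false ∷ col) (r ∷ s)       = r ∷ insertCol col s
insertCol (true  ∷ col) ((u , c) ∷ s) = (u , suc c) ∷ below col
insertCol _             _             = []

-- The flags tell which rows are unrestricted. Only these may receive a 1: in a restricted row, a
-- new first entry 1 would stand to the left of a 0 that has a 1 above it. `subCols` serves the rows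
-- below a 1 already placed, `nonzeroCols` the whole column, which must contain a 1.
subCols nonzeroCols : List Bool → List (List Bool)
subCols []           = [] ∷ []
subCols (false ∷ us) = map (false ∷_) (subCols us)
subCols (true  ∷ us) = map (false ∷_) (subCols us) ++ map (true ∷_) (subCols us)
nonzeroCols []           = []
nonzeroCols (false ∷ us) = map (false ∷_) (nonzeroCols us)
nonzeroCols (true  ∷ us) = map (false ∷_) (nonzeroCols us) ++ map (true ∷_) (subCols us)

-- If the topmost 1 of a column lies in a restricted row, then the restricted 0 is to its left, and
-- a 1 above that 0 makes the column c-restricted. Thanks to this, omitting the restricted rows from
-- the word attaches no C to a wrong R.
Consistent : State → Set
Consistent = All λ (u , c) → u ≡ false → c ≡ 0

below-consistent : ∀ col → Consistent (below col)
below-consistent []        = []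
below-consistent (_ ∷ col) = (λ _ → refl) ∷ below-consistent col

ins⁻-▷C^ : ∀ w c → ins⁻ (w ▷C^ c) ≡ ins⁻ w
ins⁻-▷C^ w zero    = refl
ins⁻-▷C^ w (suc c) = ins⁻-▷C^ w c

module StateSums (R : CommutativeRing 0ℓ 0ℓ) where
  open CommutativeRing R renaming (refl to ≈-refl)
  open Sums R
  open CommSemi +-commutativeSemigroup using (interchange)
  open SetoidReasoning setoid

  module _ (f : Word → Carrier) where
    Σbelow : List Bool → Word → Carrier
    Σbelow us v = Σ[ (λ col → f (foldl addRow v (below col))) ] (subCols us)

    Σins : List Bool → Word → State → Carrier
    Σins us w s = Σ[ (λ col → f (foldl addRow w (insertCol col s))) ] (nonzeroCols us)

    -- Invariant of a reading from top to bottom, with w the word of the rows already read. The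
    -- first sum has the columns whose topmost 1 is still to come in s; the second has those whose
    -- topmost 1 has been read, with `ins w` listing the possible new prefixes.
    Σ-insertCol : ∀ w {s} → Consistent s →
      Σins (map proj₁ s) w s + Σ[ Σbelow (map proj₁ s) ] (ins w) ≈ Σ[ f ] (ins (foldl addRow w s))
    Σ-insertCol w [] =
      trans (+-identityˡ _) (Σ-cong (ins w) (λ _ → +-identityʳ _))
    Σ-insertCol w {(false , c) ∷ s} (c≡0 ∷ ok) with refl ← c≡0 refl = begin
      Σins (false ∷ us) w ((false , 0) ∷ s) + Σ[ Σbelow (false ∷ us) ] (ins w)
        ≈⟨ +-cong (Σ-map _ _ (nonzeroCols us)) (Σ-cong (ins w) (λ _ → Σ-map _ _ (subCols us))) ⟩
      Σins us w s + Σ[ Σbelow us ] (ins w)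
        ≈⟨ Σ-insertCol w ok ⟩
      Σ[ f ] (ins (foldl addRow w s)) ∎
      where us = map proj₁ s
    Σ-insertCol w {(true , c) ∷ s} (_ ∷ ok) = begin
      Σins (true ∷ us) w ((true , c) ∷ s) + Σ[ Σbelow (true ∷ us) ] (ins w)
        ≈⟨ +-cong
             (trans (Σ-++ _ (map (false ∷_) (nonzeroCols us)) _)
                    (+-cong (Σ-map _ _ (nonzeroCols us)) (Σ-map _ _ (subCols us))))
             (Σ-cong (ins w) (λ _ → trans (Σ-++ _ (map (false ∷_) (subCols us)) _)
                    (+-cong (Σ-map _ _ (subCols us)) (Σ-map _ _ (subCols us))))) ⟩
      (Σins us w′ s + Σbelow us (w′ ▷C)) + Σ[ (λ v → Σbelow us v + Σbelow us (v ▷R)) ] (ins w)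
        ≈⟨ +-congˡ (trans (Σ-+ _ _ (ins w)) (+-congˡ (sym (Σ-map (Σbelow us) _▷R (ins w))))) ⟩
      (Σins us w′ s + Σbelow us (w′ ▷C)) + (Σ[ Σbelow us ] (ins w) + Σ[ Σbelow us ] (map _▷R (ins w)))
        ≈⟨ +-congˡ (sym (Σ-++ (Σbelow us) (ins w) _)) ⟩
      -- Under a topmost 1 further up, the row just read loses its R or keeps it, according to its
      -- entry 0 or 1; these are the two halves of `ins⁻ (w ▷R)`. The columns with topmost 1 in this
      -- very row supply `w′ ▷C`, the missing head of `ins w′`.
      (Σins us w′ s + Σbelow us (w′ ▷C)) + Σ[ Σbelow us ] (ins⁻ (w ▷R))
        ≡⟨ ≡.cong (λ vs → (Σins us w′ s + Σbelow us (w′ ▷C)) + Σ[ Σbelow us ] vs)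
             (≡.sym (ins⁻-▷C^ (w ▷R) c)) ⟩
      (Σins us w′ s + Σbelow us (w′ ▷C)) + Σ[ Σbelow us ] (ins⁻ w′)
        ≈⟨ +-assoc _ _ _ ⟩
      Σins us w′ s + Σ[ Σbelow us ] (ins w′)
        ≈⟨ Σ-insertCol w′ ok ⟩
      Σ[ f ] (ins (foldl addRow w′ s)) ∎
      where
      us = map proj₁ s
      w′ = (w ▷R) ▷C^ c

    -- The invariant after the first row: `ins (R₀ ▷C^ c)` has a single entry, which accounts for
    -- the columns that start with a 1.
    Σ-insertCol-toWord : ∀ c {s} → Consistent s →
      Σ[ (λ col → f (toWord (insertCol col ((true , c) ∷ s)))) ] (nonzeroCols (true ∷ map proj₁ s))
        ≈ Σ[ f ] (ins (toWord ((true , c) ∷ s)))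
    Σ-insertCol-toWord c {s} ok = begin
      Σ[ (λ col → f (toWord (insertCol col ((true , c) ∷ s)))) ] (nonzeroCols (true ∷ us))
        ≈⟨ trans (Σ-++ _ (map (false ∷_) (nonzeroCols us)) _)
             (+-cong (Σ-map _ _ (nonzeroCols us)) (Σ-map _ _ (subCols us))) ⟩
      Σins us w s + Σbelow us (w ▷C)
        ≈⟨ +-congˡ (sym (+-identityʳ _)) ⟩
      Σins us w s + Σ[ Σbelow us ] ((w ▷C) ∷ ins⁻ R₀)
        ≡⟨ ≡.cong (λ vs → Σins us w s + Σ[ Σbelow us ] ((w ▷C) ∷ vs)) (≡.sym (ins⁻-▷C^ R₀ c)) ⟩
      Σins us w s + Σ[ Σbelow us ] (ins w)
        ≈⟨ Σ-insertCol w ok ⟩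
      Σ[ f ] (ins (foldl addRow w s)) ∎
      where
      us = map proj₁ s
      w  = R₀ ▷C^ c

open ≡ using (sym; trans)
open import Data.Nat using (_+_)

-- Bounded quantifiers and counting

∧-true : ∀ {a b} → a ∧ b ≡ true → a ≡ true × b ≡ true
∧-true {true} {true} refl = refl , refl

true-∧ : ∀ {a b} → a ≡ true → b ≡ true → a ∧ b ≡ true
true-∧ refl refl = refl

anyB-cong : ∀ n {f h : ℕ → Bool} → (∀ i → i < n → f i ≡ h i) → anyB n f ≡ anyB n h
anyB-cong zero    p = refl
anyB-cong (suc n) p = cong₂ _∨_ (anyB-cong n (λ i i<n → p i (ℕₚ.m<n⇒m<1+n i<n))) (p n ℕₚ.≤-refl)

allB-cong : ∀ n {f h : ℕ → Bool} → (∀ i → i < n → f i ≡ h i) → allB n f ≡ allB n h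
allB-cong zero    p = refl
allB-cong (suc n) p = cong₂ _∧_ (allB-cong n (λ i i<n → p i (ℕₚ.m<n⇒m<1+n i<n))) (p n ℕₚ.≤-refl)

countB-cong : ∀ n {f h : ℕ → Bool} → (∀ i → i < n → f i ≡ h i) → countB n f ≡ countB n h
countB-cong zero    p = refl
countB-cong (suc n) p = cong₂ (λ b c → if b then suc c else c)
  (p n ℕₚ.≤-refl) (countB-cong n (λ i i<n → p i (ℕₚ.m<n⇒m<1+n i<n)))

anyB-peel : ∀ n f → anyB (suc n) f ≡ f 0 ∨ anyB n (f ∘ suc)
anyB-peel zero    f = sym (𝔹ₚ.∨-identityʳ (f 0))
anyB-peel (suc n) f = trans (cong (_∨ f (suc n)) (anyB-peel n f)) (𝔹ₚ.∨-assoc (f 0) _ _)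

allB-peel : ∀ n f → allB (suc n) f ≡ f 0 ∧ allB n (f ∘ suc)
allB-peel zero    f = sym (𝔹ₚ.∧-identityʳ (f 0))
allB-peel (suc n) f = trans (cong (_∧ f (suc n)) (allB-peel n f)) (𝔹ₚ.∧-assoc (f 0) _ _)

countB-peel : ∀ n f → countB (suc n) f ≡ (if f 0 then suc (countB n (f ∘ suc)) else countB n (f ∘ suc))
countB-peel zero    f = refl
countB-peel (suc n) f with f (suc n) | f 0 | countB-peel n f
... | false | true  | eq = eq
... | false | false | eq = eq
... | true  | true  | eq = cong suc eq
... | true  | false | eq = cong suc eq

allB-intro : ∀ n {f} → (∀ i → i < n → f i ≡ true) → allB n f ≡ true
allB-intro zero    p = refl
allB-intro (suc n) p = true-∧ (allB-intro n (λ i i<n → p i (ℕₚ.m<n⇒m<1+n i<n))) (p n ℕₚ.≤-refl)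

allB-elim : ∀ n {f} → allB n f ≡ true → ∀ i → i < n → f i ≡ true
allB-elim (suc n) {f} p i i<1+n with ∧-true {allB n f} p | ℕₚ.m≤n⇒m<n∨m≡n i<1+n
... | q , _ | inj₁ (s≤s i<n) = allB-elim n q i i<n
... | _ , q | inj₂ refl      = q

allB-false : ∀ n {f} i → i < n → f i ≡ false → allB n f ≡ false
allB-false n {f} i i<n p with allB n f in eq
... | false = refl
... | true  with () ← trans (sym p) (allB-elim n eq i i<n)

anyB-intro : ∀ n {f} i → i < n → f i ≡ true → anyB n f ≡ true
anyB-intro (suc n) {f} i i<1+n p with ℕₚ.m≤n⇒m<n∨m≡n i<1+n
... | inj₁ (s≤s i<n) = cong (_∨ f n) (anyB-intro n i i<n p)
... | inj₂ refl      = trans (cong (anyB n f ∨_) p) (𝔹ₚ.∨-zeroʳ _)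

anyB-elim : ∀ n {f} → anyB n f ≡ true → ∃ λ i → i < n × f i ≡ true
anyB-elim (suc n) {f} p with anyB n f in eq
... | false = n , ℕₚ.≤-refl , p
... | true  = let i , i<n , q = anyB-elim n eq in i , ℕₚ.m<n⇒m<1+n i<n , q

countB-false : ∀ n → countB n (λ _ → false) ≡ 0
countB-false zero    = refl
countB-false (suc n) = countB-false n

-- Used with h for a 1 in the rows seen so far and k for a 1 in the next row, so that a column is
-- counted where its first 1 occurs.
countB-disjoint : ∀ n (f h k : ℕ → Bool) →
  countB n (λ j → f j ∧ h j) + countB n (λ j → f j ∧ k j ∧ not (h j)) ≡ countB n (λ j → f j ∧ (h j ∨ k j))
countB-disjoint zero    f h k = refl
countB-disjoint (suc n) f h k with f n | h n | k n | countB-disjoint n f h k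
... | false | _     | _     | eq = eq
... | true  | true  | true  | eq = cong suc eq
... | true  | true  | false | eq = cong suc eq
... | true  | false | true  | eq = trans (ℕₚ.+-suc _ _) (cong suc eq)
... | true  | false | false | eq = eq

applyUpTo-cong : {A : Set} (n : ℕ) {f h : ℕ → A} → (∀ i → i < n → f i ≡ h i) → applyUpTo f n ≡ applyUpTo h n
applyUpTo-cong zero    p = refl
applyUpTo-cong (suc n) p = cong₂ _∷_ (p 0 (s≤s z≤n)) (applyUpTo-cong n (λ i i<n → p (suc i) (s≤s i<n)))

-- Entries and unrestricted lines of a tableau

cell : Maybe (List Bool) → ℕ → Maybe Bool
cell nothing  j = nothing
cell (just r) j = nth r j

is1 is0 : Maybe Bool → Bool
is1 (just true) = true
is1 _           = false
is0 (just false) = true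
is0 _            = false

-- `isOne` and `isZero` depend on the tableau through this value alone, so one comparison of entries
-- transfers both predicates.
entry : Tableau → ℕ → ℕ → Maybe Bool
entry T i j = cell (nth T i) j

isOne≡ : ∀ T i j → isOne T i j ≡ is1 (entry T i j)
isOne≡ T i j with nth T i
... | nothing = refl
... | just r with nth r j
...   | nothing    = refl
...   | just true  = refl
...   | just false = refl

isZero≡ : ∀ T i j → isZero T i j ≡ is0 (entry T i j)
isZero≡ T i j with nth T i
... | nothing = refl
... | just r with nth r j
...   | nothing    = refl
...   | just true  = refl
...   | just false = refl

isOne-entry : ∀ T T′ {i i′ j j′} → entry T i j ≡ entry T′ i′ j′ → isOne T i j ≡ isOne T′ i′ j′
isOne-entry T T′ {i} {i′} {j} {j′} eq = trans (isOne≡ T i j) (trans (cong is1 eq) (sym (isOne≡ T′ i′ j′)))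

isZero-entry : ∀ T T′ {i i′ j j′} → entry T i j ≡ entry T′ i′ j′ → isZero T i j ≡ isZero T′ i′ j′
isZero-entry T T′ {i} {i′} {j} {j′} eq = trans (isZero≡ T i j) (trans (cong is0 eq) (sym (isZero≡ T′ i′ j′)))

one⇒¬zero : ∀ T i j → isOne T i j ≡ true → isZero T i j ≡ false
one⇒¬zero T i j p with entry T i j | isOne≡ T i j | isZero≡ T i j
... | nothing    | e | e′ = e′
... | just true  | e | e′ = e′
... | just false | e | e′ with () ← trans (sym p) e

nth-out : {A : Set} (xs : List A) → nth xs (length xs) ≡ nothing
nth-out []       = refl
nth-out (x ∷ xs) = nth-out xs

isOne-out : ∀ T j → isOne T (length T) j ≡ false
isOne-out T j = trans (isOne≡ T (length T) j) (cong (λ r → is1 (cell r j)) (nth-out T))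

isZero-out : ∀ T j → isZero T (length T) j ≡ false
isZero-out T j = trans (isZero≡ T (length T) j) (cong (λ r → is0 (cell r j)) (nth-out T))

unrR unrC : Tableau → ℕ → Bool
unrR T i = allB (numCols T) (λ j → not (restricted T i j))
unrC T j = allB (numRows T) (λ i → not (cRestricted T i j))

top : Tableau → ℕ → ℕ → Bool
top T i j = isOne T i j ∧ not (oneAbove T i j)

topCount : Tableau → ℕ → ℕ
topCount T i = countB (numCols T) (λ j → unrC T j ∧ top T i j)

stateOf : Tableau → State
stateOf T = applyUpTo (λ i → unrR T i , topCount T i) (numRows T)

colsOK : Tableau → Bool
colsOK T = allB (numCols T) (λ j → anyB (numRows T) (λ i → isOne T i j))

rowOK : Tableau → ℕ → Bool
rowOK T i = allB (numCols T) (λ j → not (isZero T i j ∧ oneAbove T i j ∧ oneLeft T i j))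

unrR-top : ∀ T → unrR T 0 ≡ true
unrR-top T = allB-intro (numCols T) (λ j _ → cong not (𝔹ₚ.∧-zeroʳ (isZero T 0 j)))

-- Appending an empty row

module AddRow (r : List Bool) (T₀ : Tableau) where
  private
    T T′ : Tableau
    T  = r ∷ T₀
    T′ = T ∷ʳ []

  numRows-addRow : numRows T′ ≡ suc (numRows T)
  numRows-addRow = trans (length-++ T) (ℕₚ.+-comm (length T) 1)

  -- At the new index the row changes from `nothing` to `just []`, but neither has a cell. Comparing
  -- cells instead of rows thus gives equality at every index.
  nth-∷ʳ : ∀ (S : Tableau) i j → cell (nth (S ∷ʳ []) i) j ≡ cell (nth S i) j
  nth-∷ʳ []      zero    j = refl
  nth-∷ʳ []      (suc i) j = refl
  nth-∷ʳ (_ ∷ S) zero    j = refl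
  nth-∷ʳ (_ ∷ S) (suc i) j = nth-∷ʳ S i j

  one : ∀ i j → isOne T′ i j ≡ isOne T i j
  one i j = isOne-entry T′ T {i} {i} {j} {j} (nth-∷ʳ T i j)

  zer : ∀ i j → isZero T′ i j ≡ isZero T i j
  zer i j = isZero-entry T′ T {i} {i} {j} {j} (nth-∷ʳ T i j)

  above : ∀ i j → oneAbove T′ i j ≡ oneAbove T i j
  above i j = anyB-cong i (λ i′ _ → one i′ j)

  left : ∀ i j → oneLeft T′ i j ≡ oneLeft T i j
  left i j = anyB-cong j (λ j′ _ → one i j′)

  unrR-addRow : ∀ i → unrR T′ i ≡ unrR T i
  unrR-addRow i = allB-cong (numCols T) (λ j _ → cong not (cong₂ _∧_ (zer i j) (above i j)))

  unrC-addRow : ∀ j → unrC T′ j ≡ unrC T j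
  unrC-addRow j = begin
    allB (numRows T′) c′               ≡⟨ cong (λ n → allB n c′) numRows-addRow ⟩
    allB (numRows T) c′ ∧ c′ (numRows T)
      ≡⟨ cong₂ _∧_ (allB-cong (numRows T) (λ i _ → cong not (cong₂ _∧_ (zer i j) (left i j))))
           (cong (λ b → not (b ∧ oneLeft T′ (numRows T) j)) (trans (zer (numRows T) j) (isZero-out T j))) ⟩
    unrC T j ∧ true                    ≡⟨ 𝔹ₚ.∧-identityʳ _ ⟩
    unrC T j                           ∎
    where
    open ≡-Reasoning
    c′ = λ i → not (cRestricted T′ i j)

  topCount-addRow : ∀ i → topCount T′ i ≡ topCount T i
  topCount-addRow i = countB-cong (numCols T) λ j _ →
    cong₂ _∧_ (unrC-addRow j) (cong₂ (λ a b → a ∧ not b) (one i j) (above i j))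

  stateOf-addRow : stateOf T′ ≡ stateOf T ∷ʳ (true , 0)
  stateOf-addRow = begin
    applyUpTo s′ (numRows T′)           ≡⟨ cong (applyUpTo s′) numRows-addRow ⟩
    applyUpTo s′ (suc (numRows T))      ≡⟨ sym (applyUpTo-∷ʳ s′ (numRows T)) ⟩
    applyUpTo s′ (numRows T) ∷ʳ s′ (numRows T)
      ≡⟨ cong₂ _∷ʳ_ (applyUpTo-cong (numRows T) (λ i _ → cong₂ _,_ (unrR-addRow i) (topCount-addRow i)))
           (cong₂ _,_ (allB-intro (numCols T) λ j _ → cong (λ b → not (b ∧ oneAbove T′ (numRows T) j)) (zer-last j))
             (trans (countB-cong (numCols T) (λ j _ →
                trans (cong (λ b → unrC T′ j ∧ b ∧ not (oneAbove T′ (numRows T) j)) (one-last j)) (𝔹ₚ.∧-zeroʳ _)))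
                (countB-false (numCols T)))) ⟩
    stateOf T ∷ʳ (true , 0)             ∎
    where
    open ≡-Reasoning
    s′ = λ i → unrR T′ i , topCount T′ i
    zer-last : ∀ j → isZero T′ (numRows T) j ≡ false
    zer-last j = trans (zer (numRows T) j) (isZero-out T j)
    one-last : ∀ j → isOne T′ (numRows T) j ≡ false
    one-last j = trans (one (numRows T) j) (isOne-out T j)

  ferrersB-addRow : ferrersB T′ ≡ ferrersB T
  ferrersB-addRow = go r T₀
    where
    go : ∀ r T₀ → ferrersB ((r ∷ T₀) ∷ʳ []) ≡ ferrersB (r ∷ T₀)
    go r []       = refl
    go r (s ∷ T₀) = cong (_ ∧_) (go s T₀)

  isPT-addRow : isPT T′ ≡ isPT T
  isPT-addRow = cong₂ _∧_ ferrersB-addRow (cong₂ _∧_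
    (allB-cong (numCols T) (λ j _ → begin
      anyB (numRows T′) (λ i → isOne T′ i j)   ≡⟨ cong (λ n → anyB n (λ i → isOne T′ i j)) numRows-addRow ⟩
      anyB (numRows T) (λ i → isOne T′ i j) ∨ isOne T′ (numRows T) j
        ≡⟨ cong₂ _∨_ (anyB-cong (numRows T) (λ i _ → one i j)) (trans (one (numRows T) j) (isOne-out T j)) ⟩
      anyB (numRows T) (λ i → isOne T i j) ∨ false
        ≡⟨ 𝔹ₚ.∨-identityʳ _ ⟩
      anyB (numRows T) (λ i → isOne T i j) ∎))
    (begin
      allB (numRows T′) (rowOK T′)             ≡⟨ cong (λ n → allB n (rowOK T′)) numRows-addRow ⟩
      allB (numRows T) (rowOK T′) ∧ rowOK T′ (numRows T)
        ≡⟨ cong₂ _∧_ (allB-cong (numRows T) (λ i _ → allB-cong (numCols T) (λ j _ →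
               cong not (cong₂ _∧_ (zer i j) (cong₂ _∧_ (above i j) (left i j))))))
             (allB-intro (numCols T) (λ j _ →
               cong (λ b → not (b ∧ oneAbove T′ (numRows T) j ∧ oneLeft T′ (numRows T) j)) (trans (zer (numRows T) j) (isZero-out T j)))) ⟩
      allB (numRows T) (rowOK T) ∧ true        ≡⟨ 𝔹ₚ.∧-identityʳ _ ⟩
      allB (numRows T) (rowOK T)               ∎))
    where open ≡-Reasoning

-- Inserting a first column

bit : List Bool → ℕ → Bool
bit col i = is1 (nth col i)

bit-< : ∀ col i → bit col i ≡ true → i < length col
bit-< (b ∷ col) zero    p = s≤s z≤n
bit-< (b ∷ col) (suc i) p = s≤s (bit-< col i p)

is0-nth : ∀ col i → i < length col → is0 (nth col i) ≡ not (bit col i)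
is0-nth (true  ∷ col) zero    _         = refl
is0-nth (false ∷ col) zero    _         = refl
is0-nth (b     ∷ col) (suc i) (s≤s i<n) = is0-nth col i i<n

infixr 5 _⊲_
_⊲_ : List Bool → Tableau → Tableau
_⊲_ = zipWith _∷_

entry-⊲-zero : ∀ col T → length col ≡ length T → ∀ i → entry (col ⊲ T) i 0 ≡ nth col i
entry-⊲-zero []        []      _  i       = refl
entry-⊲-zero (b ∷ col) (r ∷ T) eq zero    = refl
entry-⊲-zero (b ∷ col) (r ∷ T) eq (suc i) = entry-⊲-zero col T (ℕₚ.suc-injective eq) i

entry-⊲-suc : ∀ col T → length col ≡ length T → ∀ i j → entry (col ⊲ T) i (suc j) ≡ entry T i j
entry-⊲-suc []        []      _  i       j = refl
entry-⊲-suc (b ∷ col) (r ∷ T) eq zero    j = refl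
entry-⊲-suc (b ∷ col) (r ∷ T) eq (suc i) j = entry-⊲-suc col T (ℕₚ.suc-injective eq) i j

length-⊲ : ∀ col T → length col ≡ length T → length (col ⊲ T) ≡ length T
length-⊲ []        []      _  = refl
length-⊲ (b ∷ col) (r ∷ T) eq = cong suc (length-⊲ col T (ℕₚ.suc-injective eq))

numCols-⊲ : ∀ col T → length col ≡ length T → T ≢ [] → numCols (col ⊲ T) ≡ suc (numCols T)
numCols-⊲ col       []      _ T≢[] = ⊥-elim (T≢[] refl)
numCols-⊲ (b ∷ col) (r ∷ T) _ _    = refl

≤ᵇ-suc : ∀ a b → (suc a ≤ᵇ suc b) ≡ (a ≤ᵇ b)
≤ᵇ-suc zero    b = refl
≤ᵇ-suc (suc a) b = refl

ferrersB-⊲ : ∀ col T → length col ≡ length T → ferrersB (col ⊲ T) ≡ ferrersB T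
ferrersB-⊲ []            []          _  = refl
ferrersB-⊲ (b ∷ [])      (r ∷ [])    _  = refl
ferrersB-⊲ (b ∷ c ∷ col) (r ∷ s ∷ T) eq =
  cong₂ _∧_ (≤ᵇ-suc (length s) (length r)) (ferrersB-⊲ (c ∷ col) (s ∷ T) (ℕₚ.suc-injective eq))

nth-just : ∀ {A : Set} (xs : List A) {t i} {y : A} → nth xs i ≡ just y → t < i → ∃ λ x → nth xs t ≡ just x
nth-just (x ∷ xs) {zero}  {suc i} p _         = x , refl
nth-just (x ∷ xs) {suc t} {suc i} p (s≤s t<i) = nth-just xs p t<i

≤ᵇ-≤ : ∀ a b → (a ≤ᵇ b) ≡ true → a ≤ b
≤ᵇ-≤ a b p = ℕₚ.≤ᵇ⇒≤ a b (Equivalence.from 𝔹ₚ.T-≡ p)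

ferrers-≤ : ∀ r T i {s} → ferrersB (r ∷ T) ≡ true → nth T i ≡ just s → length s ≤ length r
ferrers-≤ r (s ∷ T) zero    fer refl = ≤ᵇ-≤ (length s) (length r) (proj₁ (∧-true fer))
ferrers-≤ r (s ∷ T) (suc i) fer p    =
  ℕₚ.≤-trans (ferrers-≤ s T i (proj₂ (∧-true {length s ≤ᵇ length r} fer)) p)
             (≤ᵇ-≤ (length s) (length r) (proj₁ (∧-true fer)))

ferrers-row-≤ : ∀ T t i {r s} → ferrersB T ≡ true → t < i → nth T t ≡ just r → nth T i ≡ just s → length s ≤ length r
ferrers-row-≤ (r ∷ T)     zero    (suc i) fer _         refl q = ferrers-≤ r T i fer q
ferrers-row-≤ (r ∷ s ∷ T) (suc t) (suc i) fer (s≤s t<i) p    q =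
  ferrers-row-≤ (s ∷ T) t i (proj₂ (∧-true {length s ≤ᵇ length r} fer)) t<i p q

is1-nth-< : ∀ (r : List Bool) j → is1 (nth r j) ≡ true → j < length r
is1-nth-< (x ∷ r) zero    p = s≤s z≤n
is1-nth-< (x ∷ r) (suc j) p = s≤s (is1-nth-< r j p)

-- Rows weakly shorten downwards, so the cell above an existing cell belongs to the shape; there,
-- not being 1 means being 0.
ferrers-zero-above : ∀ T {t i j} → ferrersB T ≡ true → isOne T i j ≡ true → t < i →
  isOne T t j ≡ false → isZero T t j ≡ true
ferrers-zero-above T {t} {i} {j} fer p t<i q
  with nth T i in eqᵢ | trans (sym (isOne≡ T i j)) p
... | just s | p′ with nth-just T {t} eqᵢ t<i
...   | r , eqₜ = trans (isZero≡ T t j) (trans (cong (λ r → is0 (cell r j)) eqₜ)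
          (trans (is0-nth r j j<r) (cong not (trans (sym (cong (λ r → is1 (cell r j)) eqₜ))
            (trans (sym (isOne≡ T t j)) q)))))
  where
  j<r : j < length r
  j<r = ℕₚ.≤-trans (is1-nth-< s j p′) (ferrers-row-≤ T t i fer t<i eqₜ eqᵢ)

insertEntry : Bool → Bool × ℕ → Bool × ℕ
insertEntry b (u , c) = u , (if b then suc c else c)

-- Row i of `insertCol`, in a form comparable with `stateOf` index by index: the test asks whether
-- the topmost 1 of the column lies above row i.
insertRow : List Bool → (ℕ → Bool × ℕ) → ℕ → Bool × ℕ
insertRow col s i =
  if anyB i (bit col) then (bit col i , 0) else insertEntry (bit col i) (s i)

below-applyUpTo : ∀ col → below col ≡ applyUpTo (λ i → bit col i , 0) (length col)
below-applyUpTo []            = refl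
below-applyUpTo (true  ∷ col) = cong (_ ∷_) (below-applyUpTo col)
below-applyUpTo (false ∷ col) = cong (_ ∷_) (below-applyUpTo col)

insertCol-applyUpTo : ∀ col s →
  insertCol col (applyUpTo s (length col)) ≡ applyUpTo (insertRow col s) (length col)
insertCol-applyUpTo []            s = refl
insertCol-applyUpTo (true  ∷ col) s = cong (_ ∷_) (trans (below-applyUpTo col)
  (applyUpTo-cong (length col) λ i _ →
    cong (if_then (bit col i , 0) else insertEntry (bit col i) (s (suc i))) (sym (anyB-peel i (bit (true ∷ col))))))
insertCol-applyUpTo (false ∷ col) s = cong (_ ∷_) (trans (insertCol-applyUpTo col (s ∘ suc))
  (applyUpTo-cong (length col) λ i _ →
    cong (if_then (bit col i , 0) else insertEntry (bit col i) (s (suc i))) (sym (anyB-peel i (bit (false ∷ col))))))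

module AddCol (col : List Bool) (T : Tableau) (len : length col ≡ length T) (T≢[] : T ≢ []) where
  private
    T′ : Tableau
    T′ = col ⊲ T
    n m : ℕ
    n = numRows T
    m = numCols T

  one₀ : ∀ i → isOne T′ i 0 ≡ bit col i
  one₀ i = trans (isOne≡ T′ i 0) (cong is1 (entry-⊲-zero col T len i))

  zer₀ : ∀ i → i < n → isZero T′ i 0 ≡ not (bit col i)
  zer₀ i i<n = trans (isZero≡ T′ i 0) (trans (cong is0 (entry-⊲-zero col T len i))
    (is0-nth col i (subst (i <_) (sym len) i<n)))

  one₊ : ∀ i j → isOne T′ i (suc j) ≡ isOne T i j
  one₊ i j = isOne-entry T′ T {i} {i} {suc j} {j} (entry-⊲-suc col T len i j)

  zer₊ : ∀ i j → isZero T′ i (suc j) ≡ isZero T i j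
  zer₊ i j = isZero-entry T′ T {i} {i} {suc j} {j} (entry-⊲-suc col T len i j)

  above₀ : ∀ i → oneAbove T′ i 0 ≡ anyB i (bit col)
  above₀ i = anyB-cong i (λ i′ _ → one₀ i′)

  above₊ : ∀ i j → oneAbove T′ i (suc j) ≡ oneAbove T i j
  above₊ i j = anyB-cong i (λ i′ _ → one₊ i′ j)

  left₊ : ∀ i j → oneLeft T′ i (suc j) ≡ bit col i ∨ oneLeft T i j
  left₊ i j = trans (anyB-peel j (isOne T′ i)) (cong₂ _∨_ (one₀ i) (anyB-cong j (λ j′ _ → one₊ i j′)))

  rows : numRows T′ ≡ n
  rows = length-⊲ col T len

  cols : numCols T′ ≡ suc m
  cols = numCols-⊲ col T len T≢[]

  unrR-⊲ : ∀ i → i < n → unrR T′ i ≡ not (not (bit col i) ∧ anyB i (bit col)) ∧ unrR T i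
  unrR-⊲ i i<n = begin
    allB (numCols T′) r′                ≡⟨ cong (λ k → allB k r′) cols ⟩
    allB (suc m) r′                     ≡⟨ allB-peel m r′ ⟩
    r′ 0 ∧ allB m (r′ ∘ suc)
      ≡⟨ cong₂ _∧_ (cong not (cong₂ _∧_ (zer₀ i i<n) (above₀ i)))
           (allB-cong m (λ j _ → cong not (cong₂ _∧_ (zer₊ i j) (above₊ i j)))) ⟩
    not (not (bit col i) ∧ anyB i (bit col)) ∧ unrR T i ∎
    where
    open ≡-Reasoning
    r′ = λ j → not (restricted T′ i j)

  -- A new 1 stands to the left of every old entry of its row, so the forbidden zeros become exactly
  -- the restricted ones. A new 0 changes nothing, and the first cell itself has nothing to its
  -- left.
  rowOK-⊲ : ∀ i → rowOK T′ i ≡ (if bit col i then unrR T i else rowOK T i)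
  rowOK-⊲ i = begin
    allB (numCols T′) r′                ≡⟨ cong (λ k → allB k r′) cols ⟩
    allB (suc m) r′                     ≡⟨ allB-peel m r′ ⟩
    r′ 0 ∧ allB m (r′ ∘ suc)
      ≡⟨ cong₂ _∧_ r′₀
           (allB-cong m (λ j _ → cong not (cong₂ _∧_ (zer₊ i j) (cong₂ _∧_ (above₊ i j) (left₊ i j))))) ⟩
    allB m (λ j → not (isZero T i j ∧ oneAbove T i j ∧ (bit col i ∨ oneLeft T i j)))
      ≡⟨ split (bit col i) ⟩
    (if bit col i then unrR T i else rowOK T i) ∎
    where
    open ≡-Reasoning
    r′ = λ j → not (isZero T′ i j ∧ oneAbove T′ i j ∧ oneLeft T′ i j)
    r′₀ : r′ 0 ≡ true
    r′₀ = cong not (trans (cong (isZero T′ i 0 ∧_) (𝔹ₚ.∧-zeroʳ _)) (𝔹ₚ.∧-zeroʳ _))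
    split : ∀ b → allB m (λ j → not (isZero T i j ∧ oneAbove T i j ∧ (b ∨ oneLeft T i j)))
                  ≡ (if b then unrR T i else rowOK T i)
    split false = refl
    split true  = allB-cong m (λ j _ → cong (λ b → not (isZero T i j ∧ b)) (𝔹ₚ.∧-identityʳ _))

  colsOK-⊲ : colsOK T′ ≡ anyB n (bit col) ∧ colsOK T
  colsOK-⊲ = begin
    allB (numCols T′) (λ j → anyB (numRows T′) (λ i → isOne T′ i j))
      ≡⟨ cong₂ (λ a b → allB a (λ j → anyB b (λ i → isOne T′ i j))) cols rows ⟩
    allB (suc m) (λ j → anyB n (λ i → isOne T′ i j))
      ≡⟨ allB-peel m _ ⟩
    anyB n (λ i → isOne T′ i 0) ∧ allB m (λ j → anyB n (λ i → isOne T′ i (suc j)))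
      ≡⟨ cong₂ _∧_ (anyB-cong n (λ i _ → one₀ i))
           (allB-cong m (λ j _ → anyB-cong n (λ i _ → one₊ i j))) ⟩
    anyB n (bit col) ∧ colsOK T ∎
    where open ≡-Reasoning

  unrR⇒rowOK : ∀ i → unrR T i ≡ true → rowOK T i ≡ true
  unrR⇒rowOK i p = allB-intro m λ j j<m → weaken (isZero T i j) (oneAbove T i j) (allB-elim m p j j<m)
    where
    weaken : ∀ a b {c} → not (a ∧ b) ≡ true → not (a ∧ b ∧ c) ≡ true
    weaken true  false _ = refl
    weaken false _     _ = refl

  Valid : Set
  Valid = ∀ i → bit col i ≡ true → unrR T i ≡ true

  isPT-⊲⁺ : isPT T ≡ true → Valid → anyB n (bit col) ≡ true → isPT T′ ≡ true
  isPT-⊲⁺ pt val some with ∧-true {ferrersB T} pt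
  ... | fer , pt′ with ∧-true {colsOK T} pt′
  ...   | cs , rs = true-∧ (trans (ferrersB-⊲ col T len) fer)
    (true-∧ (trans colsOK-⊲ (true-∧ some cs))
            (trans (cong (λ k → allB k (rowOK T′)) rows) (allB-intro n ok)))
    where
    ok : ∀ i → i < n → rowOK T′ i ≡ true
    ok i i<n with bit col i | val i | rowOK-⊲ i
    ... | true  | v | eq = trans eq (v refl)
    ... | false | v | eq = trans eq (allB-elim n rs i i<n)

  isPT-⊲⁻ : isPT T′ ≡ true → isPT T ≡ true × Valid × anyB n (bit col) ≡ true
  isPT-⊲⁻ pt with ∧-true {ferrersB T′} pt
  ... | fer , pt′ with ∧-true {colsOK T′} pt′
  ...   | cs , rs with ∧-true {anyB n (bit col)} (trans (sym colsOK-⊲) cs)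
  ...     | some , cs′ =
    true-∧ (trans (sym (ferrersB-⊲ col T len)) fer) (true-∧ cs′ (allB-intro n ok)) , val , some
    where
    row : ∀ i → i < n → (if bit col i then unrR T i else rowOK T i) ≡ true
    row i i<n = trans (sym (rowOK-⊲ i))
      (allB-elim n (trans (cong (λ k → allB k (rowOK T′)) (sym rows)) rs) i i<n)
    val : Valid
    val i p = trans (cong (if_then unrR T i else rowOK T i) (sym p))
      (row i (subst (i <_) len (bit-< col i p)))
    ok : ∀ i → i < n → rowOK T i ≡ true
    ok i i<n with bit col i | row i i<n
    ... | true  | q = unrR⇒rowOK i q
    ... | false | q = q

  module _ (fer : ferrersB T ≡ true) (val : Valid) where

    unrC-⊲-zero : unrC T′ 0 ≡ true
    unrC-⊲-zero = allB-intro (numRows T′) (λ i _ → cong not (𝔹ₚ.∧-zeroʳ _))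

    unrC-⊲-suc : ∀ j → unrC T′ (suc j) ≡ allB n (λ i → not (isZero T i j ∧ (bit col i ∨ oneLeft T i j)))
    unrC-⊲-suc j = trans (cong (λ k → allB k (λ i → not (cRestricted T′ i (suc j)))) rows)
      (allB-cong n (λ i _ → cong not (cong₂ _∧_ (zer₊ i j) (left₊ i j))))

    -- A column stays unrestricted iff no 1 of the new column lies above its topmost 1: the zeros
    -- below its topmost 1 are in restricted rows, where the new column is 0.
    unrC-⊲-top : ∀ i j → i < n → j < m → top T i j ≡ true →
      unrC T′ (suc j) ≡ (if anyB i (bit col) then false else unrC T j)
    unrC-⊲-top i j i<n j<m istop with ∧-true {isOne T i j} istop
    ... | isone , notabove with anyB i (bit col) in any
    -- Row t has a 1 in the new column and lies above the topmost 1 of column j; its cell in column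
    -- j is thus a 0 that now has a 1 to its left.
    ...   | true  = let t , t<i , p = anyB-elim i any in
      trans (unrC-⊲-suc j) (allB-false n t (ℕₚ.<-trans t<i i<n)
        (cong not (cong₂ (λ a b → a ∧ (b ∨ oneLeft T t j)) (zero-at t t<i) p)))
      where
      notone : ∀ t → t < i → isOne T t j ≡ false
      notone t t<i with isOne T t j in eq
      ... | false = refl
      ... | true  with () ← trans (sym notabove) (cong not (anyB-intro i t t<i eq))
      zero-at : ∀ t → t < i → isZero T t j ≡ true
      zero-at t t<i = ferrers-zero-above T fer isone t<i (notone t t<i)
    ...   | false = trans (unrC-⊲-suc j) (allB-cong n same)
      where
      not-restricted : ∀ i′ → i < i′ → unrR T i′ ≡ true → isZero T i′ j ≡ false
      not-restricted i′ i<i′ u with isZero T i′ j | oneAbove T i′ j | anyB-intro i′ {λ k → isOne T k j} i i<i′ isone | allB-elim m u j j<m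
      ... | false | _    | _ | _ = refl
      ... | true  | true | _ | ()
      nonzero : ∀ i′ → bit col i′ ≡ true → isZero T i′ j ≡ false
      nonzero i′ p with ℕₚ.<-cmp i′ i
      ... | tri< i′<i _ _ with () ← trans (sym any) (anyB-intro i i′ i′<i p)
      ... | tri≈ _ refl _ = one⇒¬zero T i′ j isone
      ... | tri> _ _ i<i′ = not-restricted i′ i<i′ (val i′ p)
      same : ∀ i′ → i′ < n → not (isZero T i′ j ∧ (bit col i′ ∨ oneLeft T i′ j)) ≡ not (cRestricted T i′ j)
      same i′ _ with bit col i′ | nonzero i′
      ... | false | _  = refl
      ... | true  | nz rewrite nz refl = refl

    topCount-⊲ : ∀ i → i < n → topCount T′ i ≡
      (if anyB i (bit col) then 0 else (if bit col i then suc (topCount T i) else topCount T i))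
    topCount-⊲ i i<n = begin
      countB (numCols T′) f′            ≡⟨ cong (λ k → countB k f′) cols ⟩
      countB (suc m) f′                 ≡⟨ countB-peel m f′ ⟩
      (if f′ 0 then suc (countB m (f′ ∘ suc)) else countB m (f′ ∘ suc))
        ≡⟨ cong₂ (λ b c → if b then suc c else c) f′₀ (countB-cong m f′₊) ⟩
      (if bit col i ∧ not (anyB i (bit col)) then suc (rest (anyB i (bit col))) else rest (anyB i (bit col)))
        ≡⟨ split (bit col i) (anyB i (bit col)) ⟩
      (if anyB i (bit col) then 0 else (if bit col i then suc (topCount T i) else topCount T i)) ∎
      where
      open ≡-Reasoning
      f f′ : ℕ → Bool
      f j  = unrC T j ∧ top T i j
      f′ j = unrC T′ j ∧ top T′ i j
      rest : Bool → ℕ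
      rest b = countB m (λ j → if b then false else f j)
      f′₀ : f′ 0 ≡ bit col i ∧ not (anyB i (bit col))
      f′₀ = trans (cong (_∧ top T′ i 0) unrC-⊲-zero) (cong₂ (λ a b → a ∧ not b) (one₀ i) (above₀ i))
      -- The change of `unrC` is known for the columns with topmost 1 in row i; for all others both
      -- conjunctions are false.
      f′₊ : ∀ j → j < m → f′ (suc j) ≡ (if anyB i (bit col) then false else f j)
      f′₊ j j<m = trans (cong (unrC T′ (suc j) ∧_) (cong₂ (λ a b → a ∧ not b) (one₊ i j) (above₊ i j)))
                        (by-top (top T i j) (anyB i (bit col)) (unrC-⊲-top i j i<n j<m))
        where
        by-top : ∀ t b {a c} → (t ≡ true → a ≡ (if b then false else c)) →
                 a ∧ t ≡ (if b then false else c ∧ t)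
        by-top false true  {a} {c} p = 𝔹ₚ.∧-zeroʳ a
        by-top false false {a} {c} p = trans (𝔹ₚ.∧-zeroʳ a) (sym (𝔹ₚ.∧-zeroʳ c))
        by-top true  true  {a} {c} p = trans (𝔹ₚ.∧-identityʳ a) (p refl)
        by-top true  false {a} {c} p = cong (_∧ true) (p refl)
      split : ∀ a b → (if a ∧ not b then suc (rest b) else rest b)
                      ≡ (if b then 0 else (if a then suc (topCount T i) else topCount T i))
      split true  true  = countB-false m
      split false true  = countB-false m
      split true  false = refl
      split false false = refl

    stateOf-⊲ : stateOf T′ ≡ insertCol col (stateOf T)
    stateOf-⊲ = begin
      applyUpTo s′ (numRows T′)              ≡⟨ cong (applyUpTo s′) rows ⟩
      applyUpTo s′ n                         ≡⟨ applyUpTo-cong n step′ ⟩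
      applyUpTo (insertRow col s) n          ≡⟨ cong (applyUpTo (insertRow col s)) (sym len) ⟩
      applyUpTo (insertRow col s) (length col) ≡⟨ sym (insertCol-applyUpTo col s) ⟩
      insertCol col (applyUpTo s (length col)) ≡⟨ cong (λ k → insertCol col (applyUpTo s k)) len ⟩
      insertCol col (stateOf T) ∎
      where
      open ≡-Reasoning
      s s′ : ℕ → Bool × ℕ
      s  i = unrR T i , topCount T i
      s′ i = unrR T′ i , topCount T′ i
      -- For a = b = true the left flag is u, and validity makes it true: a row below the topmost 1
      -- that receives a 1 was unrestricted before.
      combine : ∀ a b u c → (a ≡ true → u ≡ true) →
        (not (not a ∧ b) ∧ u , (if b then 0 else (if a then suc c else c)))
          ≡ (if b then (a , 0) else (u , (if a then suc c else c)))
      combine true  true  u c v = cong (_, 0) (v refl)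
      combine false true  u c v = refl
      combine true  false u c v = refl
      combine false false u c v = refl
      step′ : ∀ i → i < n → s′ i ≡ insertRow col s i
      step′ i i<n = trans (cong₂ _,_ (unrR-⊲ i i<n) (topCount-⊲ i i<n))
        (combine (bit col i) (anyB i (bit col)) (unrR T i) (topCount T i) (val i))

-- The statistics as totals over the state

trues sumC : State → ℕ
trues []                = 0
trues ((true  , _) ∷ s) = suc (trues s)
trues ((false , _) ∷ s) = trues s
sumC []            = 0
sumC ((_ , c) ∷ s) = c + sumC s

sumC-∷ʳ : ∀ s u c → sumC (s ∷ʳ (u , c)) ≡ sumC s + c
sumC-∷ʳ []            u c = ℕₚ.+-identityʳ c
sumC-∷ʳ ((_ , d) ∷ s) u c = trans (cong (λ e → d + e) (sumC-∷ʳ s u c)) (sym (ℕₚ.+-assoc d (sumC s) c))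

trues-applyUpTo : ∀ n s → trues (applyUpTo s n) ≡ countB n (proj₁ ∘ s)
trues-applyUpTo zero    s = refl
trues-applyUpTo (suc n) s with s 0 | countB-peel n (proj₁ ∘ s)
... | true  , _ | eq = trans (cong suc (trues-applyUpTo n (s ∘ suc))) (sym eq)
... | false , _ | eq = trans (trues-applyUpTo n (s ∘ suc)) (sym eq)

urr≡trues : ∀ T → urr T ≡ trues (stateOf T)
urr≡trues T = sym (trues-applyUpTo (numRows T) _)

-- Each column containing a 1 is counted once, at its topmost 1. The predicates are arbitrary
-- because the induction varies the number of rows, while `unrC T`, taken for f, looks at all rows
-- of T.
sumC-applyUpTo : ∀ m n (u f : ℕ → Bool) (o : ℕ → ℕ → Bool) →
  sumC (applyUpTo (λ i → u i , countB m (λ j → f j ∧ o i j ∧ not (anyB i (λ k → o k j)))) n)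
    ≡ countB m (λ j → f j ∧ anyB n (λ i → o i j))
sumC-applyUpTo m zero    u f o =
  sym (trans (countB-cong m (λ j _ → 𝔹ₚ.∧-zeroʳ (f j))) (countB-false m))
sumC-applyUpTo m (suc n) u f o = begin
  sumC (applyUpTo s (suc n))          ≡⟨ cong sumC (sym (applyUpTo-∷ʳ s n)) ⟩
  sumC (applyUpTo s n ∷ʳ s n)         ≡⟨ sumC-∷ʳ (applyUpTo s n) (u n) _ ⟩
  sumC (applyUpTo s n) + proj₂ (s n)  ≡⟨ cong (_+ proj₂ (s n)) (sumC-applyUpTo m n u f o) ⟩
  countB m (λ j → f j ∧ anyB n (λ i → o i j)) + proj₂ (s n)
    ≡⟨ countB-disjoint m f (λ j → anyB n (λ i → o i j)) (o n) ⟩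
  countB m (λ j → f j ∧ anyB (suc n) (λ i → o i j)) ∎
  where
  open ≡-Reasoning
  s : ℕ → Bool × ℕ
  s i = u i , countB m (λ j → f j ∧ o i j ∧ not (anyB i (λ k → o k j)))

urc≡sumC : ∀ T → isPT T ≡ true → urc T ≡ sumC (stateOf T)
urc≡sumC T pt = sym (trans (sumC-applyUpTo (numCols T) (numRows T) (unrR T) (unrC T) (isOne T))
  (countB-cong (numCols T) λ j j<m →
    trans (cong (unrC T j ∧_) (allB-elim (numCols T) cs j j<m)) (𝔹ₚ.∧-identityʳ _)))
  where
  cs : colsOK T ≡ true
  cs = proj₁ (∧-true {colsOK T} (proj₂ (∧-true {ferrersB T} pt)))

-- Lists without repetition

module _ {A B : Set} where
  ∈-concatMap-intro : (f : A → List B) {xs : List A} {x : A} {y : B} → x ∈ xs → y ∈ f x → y ∈ concatMap f xs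
  ∈-concatMap-intro f x∈xs y∈fx = ∈-concatMap⁺ f (lose x∈xs y∈fx)

  ∈-concatMap-elim : (f : A → List B) (xs : List A) {y : B} → y ∈ concatMap f xs → ∃ λ x → x ∈ xs × y ∈ f x
  ∈-concatMap-elim f xs p = find (∈-concatMap⁻ f {xs} p)

  concatMap-unique : (f : A → List B) {xs : List A} → Unique xs → (∀ {x} → x ∈ xs → Unique (f x)) →
    (∀ {x y z} → x ∈ xs → y ∈ xs → z ∈ f x → z ∈ f y → x ≡ y) → Unique (concatMap f xs)
  concatMap-unique f {[]}     []          uf inj = []
  concatMap-unique f {x ∷ xs} (x∉xs ∷ u) uf inj =
    Uniq.++⁺ (uf (here refl)) (concatMap-unique f u (uf ∘ there) (λ p q → inj (there p) (there q)))
      λ (z∈fx , z∈rest) → let y , y∈xs , z∈fy = ∈-concatMap-elim f xs z∈rest in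
        All.lookup x∉xs y∈xs (inj (here refl) (there y∈xs) z∈fx z∈fy)

  -- Injectivity is required just on the entries of the list: `_⊲_` truncates to the shorter
  -- argument, and cancels only for matching lengths.
  map-unique : (f : A → B) {xs : List A} → Unique xs →
    (∀ {x y} → x ∈ xs → y ∈ xs → f x ≡ f y → x ≡ y) → Unique (map f xs)
  map-unique f {[]}     []         inj = []
  map-unique f {x ∷ xs} (x∉xs ∷ u) inj =
    Allₚ.map⁺ (All.tabulate λ y∈xs fx≡fy → All.lookup x∉xs y∈xs (inj (here refl) (there y∈xs) fx≡fy))
    ∷ map-unique f u (λ p q → inj (there p) (there q))

-- Admissible columns

Below : List Bool → (ℕ → Bool) → Set
Below col u = ∀ i → bit col i ≡ true → u i ≡ true

∈-subCols⁺ : ∀ u col → Below col u → col ∈ subCols (applyUpTo u (length col))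
∈-subCols⁺ u []            v = here refl
∈-subCols⁺ u (true  ∷ col) v with u 0 | v 0 refl
... | true | refl = ∈-++⁺ʳ (map (false ∷_) _) (∈-map⁺ (true ∷_) (∈-subCols⁺ (u ∘ suc) col (v ∘ suc)))
∈-subCols⁺ u (false ∷ col) v with u 0
... | true  = ∈-++⁺ˡ (∈-map⁺ (false ∷_) (∈-subCols⁺ (u ∘ suc) col (v ∘ suc)))
... | false = ∈-map⁺ (false ∷_) (∈-subCols⁺ (u ∘ suc) col (v ∘ suc))

∈-nonzeroCols⁺ : ∀ u col → Below col u → anyB (length col) (bit col) ≡ true →
  col ∈ nonzeroCols (applyUpTo u (length col))
∈-nonzeroCols⁺ u (true  ∷ col) v some with u 0 | v 0 refl
... | true | refl = ∈-++⁺ʳ (map (false ∷_) _) (∈-map⁺ (true ∷_) (∈-subCols⁺ (u ∘ suc) col (v ∘ suc)))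
∈-nonzeroCols⁺ u (false ∷ col) v some
  with u 0 | ∈-nonzeroCols⁺ (u ∘ suc) col (v ∘ suc) (trans (sym (anyB-peel (length col) (bit (false ∷ col)))) some)
... | true  | p = ∈-++⁺ˡ (∈-map⁺ (false ∷_) p)
... | false | p = ∈-map⁺ (false ∷_) p

∷-below : ∀ {b col u} → (b ≡ true → u 0 ≡ true) → Below col (u ∘ suc) → Below (b ∷ col) u
∷-below {true} p v zero    q = p refl
∷-below        p v (suc i) q = v i q

∈-subCols⁻ : ∀ u n {col} → col ∈ subCols (applyUpTo u n) → length col ≡ n × Below col u
∈-subCols⁻ u zero    (here refl) = refl , λ _ ()
∈-subCols⁻ u (suc n) p with u 0 in eq
... | false with _ , q , refl ← ∈-map⁻ (false ∷_) p =
  let l , v = ∈-subCols⁻ (u ∘ suc) n q in cong suc l , ∷-below (λ ()) v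
... | true with ∈-++⁻ (map (false ∷_) (subCols (applyUpTo (u ∘ suc) n))) p
...   | inj₁ p′ with _ , q , refl ← ∈-map⁻ (false ∷_) p′ =
  let l , v = ∈-subCols⁻ (u ∘ suc) n q in cong suc l , ∷-below (λ ()) v
...   | inj₂ p′ with _ , q , refl ← ∈-map⁻ (true ∷_) p′ =
  let l , v = ∈-subCols⁻ (u ∘ suc) n q in cong suc l , ∷-below (λ _ → eq) v

∈-nonzeroCols⁻ : ∀ u n {col} → col ∈ nonzeroCols (applyUpTo u n) →
  length col ≡ n × Below col u × anyB n (bit col) ≡ true
∈-nonzeroCols⁻ u (suc n) p with u 0 in eq
... | false with _ , q , refl ← ∈-map⁻ (false ∷_) p =
  let l , v , some = ∈-nonzeroCols⁻ (u ∘ suc) n q in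
  cong suc l , ∷-below (λ ()) v , trans (anyB-peel n _) some
... | true with ∈-++⁻ (map (false ∷_) (nonzeroCols (applyUpTo (u ∘ suc) n))) p
...   | inj₁ p′ with _ , q , refl ← ∈-map⁻ (false ∷_) p′ =
  let l , v , some = ∈-nonzeroCols⁻ (u ∘ suc) n q in
  cong suc l , ∷-below (λ ()) v , trans (anyB-peel n _) some
...   | inj₂ p′ with _ , q , refl ← ∈-map⁻ (true ∷_) p′ =
  let l , v = ∈-subCols⁻ (u ∘ suc) n q in
  cong suc l , ∷-below (λ _ → eq) v , anyB-peel n _

false∷-true∷-disjoint : ∀ (xs ys : List (List Bool)) {z} → z ∈ map (false ∷_) xs × z ∈ map (true ∷_) ys → ⊥
false∷-true∷-disjoint xs ys (p , q) with ∈-map⁻ (false ∷_) p | ∈-map⁻ (true ∷_) q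
... | _ , _ , refl | _ , _ , ()

subCols-unique : ∀ us → Unique (subCols us)
subCols-unique []           = [] ∷ []
subCols-unique (false ∷ us) = Uniq.map⁺ ∷-injectiveʳ (subCols-unique us)
subCols-unique (true  ∷ us) = Uniq.++⁺ (Uniq.map⁺ ∷-injectiveʳ (subCols-unique us))
  (Uniq.map⁺ ∷-injectiveʳ (subCols-unique us)) (false∷-true∷-disjoint (subCols us) (subCols us))

nonzeroCols-unique : ∀ us → Unique (nonzeroCols us)
nonzeroCols-unique []           = []
nonzeroCols-unique (false ∷ us) = Uniq.map⁺ ∷-injectiveʳ (nonzeroCols-unique us)
nonzeroCols-unique (true  ∷ us) = Uniq.++⁺ (Uniq.map⁺ ∷-injectiveʳ (nonzeroCols-unique us))
  (Uniq.map⁺ ∷-injectiveʳ (subCols-unique us)) (false∷-true∷-disjoint (nonzeroCols us) (subCols us))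

-- A count grows only at the topmost 1 of the new column, which sits in an unrestricted row, and all
-- rows below get count 0.
insertCol-consistent : ∀ {s col} → Consistent s → col ∈ nonzeroCols (map proj₁ s) → Consistent (insertCol col s)
insertCol-consistent {(false , c) ∷ s} (h ∷ ok) p with _ , q , refl ← ∈-map⁻ (false ∷_) p =
  h ∷ insertCol-consistent ok q
insertCol-consistent {(true , c) ∷ s} (h ∷ ok) p
  with ∈-++⁻ (map (false ∷_) (nonzeroCols (map proj₁ s))) p
... | inj₁ p′ with _ , q , refl ← ∈-map⁻ (false ∷_) p′ = h ∷ insertCol-consistent ok q
... | inj₂ p′ with col , q , refl ← ∈-map⁻ (true ∷_) p′ = (λ ()) ∷ below-consistent col

-- Generating all permutation tableaux

newCols : Tableau → List (List Bool)
newCols T = nonzeroCols (map proj₁ (stateOf T))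

children : Tableau → List Tableau
children T = (T ∷ʳ []) ∷ map (_⊲ T) (newCols T)

gen : ℕ → List Tableau
gen zero    = ([] ∷ []) ∷ []
gen (suc n) = concatMap children (gen n)

newCols≡ : ∀ T → newCols T ≡ nonzeroCols (applyUpTo (unrR T) (numRows T))
newCols≡ T = cong nonzeroCols (map-applyUpTo _ proj₁ (numRows T))

∈-newCols⁻ : ∀ T {col} → col ∈ newCols T →
  length col ≡ length T × Below col (unrR T) × anyB (length T) (bit col) ≡ true
∈-newCols⁻ T p = ∈-nonzeroCols⁻ (unrR T) (numRows T) (subst (_ ∈_) (newCols≡ T) p)

∈-newCols⁺ : ∀ T {col} → length col ≡ length T → Below col (unrR T) → anyB (length T) (bit col) ≡ true → col ∈ newCols T
∈-newCols⁺ T {col} len v some = subst (col ∈_) (sym (newCols≡ T))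
  (subst (λ k → col ∈ nonzeroCols (applyUpTo (unrR T) k)) len
    (∈-nonzeroCols⁺ (unrR T) col v (trans (cong (λ k → anyB k (bit col)) len) some)))

record Good (n : ℕ) (T : Tableau) : Set where
  field
    pt         : isPT T ≡ true
    len        : tabLength T ≡ suc n
    consistent : Consistent (stateOf T)

  T≢[] : T ≢ []
  T≢[] refl with () ← len

  fer : ferrersB T ≡ true
  fer = proj₁ (∧-true {ferrersB T} pt)

open Good

good-addRow : ∀ {n T} → Good n T → Good (suc n) (T ∷ʳ [])
good-addRow {n} {[]}     G = ⊥-elim (T≢[] G refl)
good-addRow {n} {r ∷ T₀} G = record
  { pt = trans isPT-addRow (pt G)
  ; len = trans (cong (_+ length r) numRows-addRow) (cong suc (len G))
  ; consistent = subst Consistent (sym stateOf-addRow) (Allₚ.∷ʳ⁺ (consistent G) (λ ()))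
  }
  where open AddRow r T₀

good-⊲ : ∀ {n T col} → Good n T → col ∈ newCols T → Good (suc n) (col ⊲ T)
good-⊲ {n} {T} {col} G p = record
  { pt = isPT-⊲⁺ (pt G) v some
  ; len = trans (cong₂ _+_ rows cols) (trans (ℕₚ.+-suc (numRows T) (numCols T)) (cong suc (len G)))
  ; consistent = subst Consistent (sym (stateOf-⊲ (fer G) v)) (insertCol-consistent (consistent G) p)
  }
  where
  l    = proj₁ (∈-newCols⁻ T p)
  v    = proj₁ (proj₂ (∈-newCols⁻ T p))
  some = proj₂ (proj₂ (∈-newCols⁻ T p))
  open AddCol col T l (T≢[] G)

gen-good : ∀ n {T} → T ∈ gen n → Good n T
gen-good zero    (here refl) = record { pt = refl ; len = refl ; consistent = (λ ()) ∷ [] }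
gen-good (suc n) p with ∈-concatMap-elim children (gen n) p
... | T , T∈ , here refl = good-addRow (gen-good n T∈)
... | T , T∈ , there q with col , col∈ , refl ← ∈-map⁻ (_⊲ T) q = good-⊲ (gen-good n T∈) col∈

-- In a Ferrers shape either the last row is empty, or no row is and the first column can be split
-- off. This inverts the two ways of growing a tableau.
emptyRow⊎column : ∀ T → ferrersB T ≡ true →
  (∃ λ S → T ≡ S ∷ʳ []) ⊎ (∃₂ λ col S → length col ≡ length S × T ≡ col ⊲ S)
emptyRow⊎column [] _   = inj₂ ([] , [] , refl , refl)
emptyRow⊎column ([] ∷ []) _   = inj₁ ([] , refl)
emptyRow⊎column ((b ∷ r) ∷ []) _   = inj₂ (b ∷ [] , r ∷ [] , refl , refl)
emptyRow⊎column (r ∷ s ∷ T) fer with emptyRow⊎column (s ∷ T) (proj₂ (∧-true {length s ≤ᵇ length r} fer))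
... | inj₁ (S , eq) = inj₁ (r ∷ S , cong (r ∷_) eq)
emptyRow⊎column ((b ∷ r) ∷ s ∷ T) fer | inj₂ (col , S , l , eq) = inj₂ (b ∷ col , r ∷ S , cong suc l , cong ((b ∷ r) ∷_) eq)
-- Under an empty first row the next row is empty too, so what lies below it has no first column to
-- split off.
emptyRow⊎column ([] ∷ [] ∷ T) fer | inj₂ (_ ∷ _ , _ ∷ _ , _ , ())

-- Removing an empty last row or the first column lowers the length by one and leaves a permutation
-- tableau; for the column this is `isPT-⊲⁻`, which also shows that the column was admissible.
gen-complete : ∀ n T → isPT T ≡ true → tabLength T ≡ suc n → T ∈ gen n
gen-complete zero ([] ∷ [])           pt len = here refl
gen-complete zero (_ ∷ _ ∷ _)         pt ()
gen-complete (suc n) T pt len with emptyRow⊎column T (proj₁ (∧-true {ferrersB T} pt))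
... | inj₁ ([] , refl) with () ← len
... | inj₁ (r ∷ S , refl) =
  ∈-concatMap-intro children (gen-complete n (r ∷ S) (trans (sym isPT-addRow) pt)
    (ℕₚ.suc-injective (trans (sym (cong (_+ length r) numRows-addRow)) len))) (here refl)
  where open AddRow r S
... | inj₂ ([] , [] , l , refl) with () ← len
... | inj₂ (col , S@(_ ∷ _) , l , refl) with AddCol.isPT-⊲⁻ col S l (λ ()) pt
...   | ptS , v , some = ∈-concatMap-intro children
  (gen-complete n S ptS (ℕₚ.suc-injective (trans (sym (trans (cong₂ _+_ rows cols) (ℕₚ.+-suc (numRows S) (numCols S)))) len)))
  (there (∈-map⁺ (_⊲ S) (∈-newCols⁺ S l v some)))
  where open AddCol col S l (λ ())

⊲-injective : ∀ {col col′ T T′} → length col ≡ length T → length col′ ≡ length T′ →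
  col ⊲ T ≡ col′ ⊲ T′ → col ≡ col′ × T ≡ T′
⊲-injective {[]}    {[]}    {[]}    {[]}    _ _  _  = refl , refl
⊲-injective {[]}    {[]}    {[]}    {_ ∷ _} _ () _
⊲-injective {[]}    {_ ∷ _} {[]}    {_ ∷ _} _ _  ()
⊲-injective {_ ∷ _} {_ ∷ _} {_ ∷ _} {_ ∷ _} l l′ eq
  with refl , eq′ ← ∷-injective eq
  with refl , refl ← ⊲-injective (ℕₚ.suc-injective l) (ℕₚ.suc-injective l′) eq′ = refl , refl

[]∉⊲ : ∀ col T → [] ∈ col ⊲ T → ⊥
[]∉⊲ (_ ∷ col) (_ ∷ T) (there p) = []∉⊲ col T p

-- An empty row distinguishes the two kinds of children, so no tableau is generated in both ways.
addRow≢⊲ : ∀ S col T → S ∷ʳ [] ≡ col ⊲ T → ⊥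
addRow≢⊲ S col T eq = []∉⊲ col T (subst ([] ∈_) eq (∈-++⁺ʳ S (here refl)))

newCols-length : ∀ T {col} → col ∈ newCols T → length col ≡ length T
newCols-length T p = proj₁ (∈-newCols⁻ T p)

children-unique : ∀ T → Unique (children T)
children-unique T =
  Allₚ.map⁺ (All.tabulate (λ {col} _ → addRow≢⊲ T col T))
  ∷ map-unique (_⊲ T) (nonzeroCols-unique (map proj₁ (stateOf T)))
      (λ p q eq → proj₁ (⊲-injective (newCols-length T p) (newCols-length T q) eq))

children-disjoint : ∀ {S T U} → U ∈ children S → U ∈ children T → S ≡ T
children-disjoint {S} {T} (here refl) (here eq)   = ∷ʳ-injectiveˡ S T eq
children-disjoint {S} {T} (here refl) (there q) with col , _ , eq ← ∈-map⁻ (_⊲ T) q =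
  ⊥-elim (addRow≢⊲ S col T eq)
children-disjoint {S} {T} (there p) (here refl) with col , _ , eq ← ∈-map⁻ (_⊲ S) p =
  ⊥-elim (addRow≢⊲ T col S eq)
children-disjoint {S} {T} (there p) (there q)
  with _ , r , refl ← ∈-map⁻ (_⊲ S) p | _ , r′ , eq ← ∈-map⁻ (_⊲ T) q =
  proj₂ (⊲-injective (newCols-length S r) (newCols-length T r′) eq)

gen-unique : ∀ n → Unique (gen n)
gen-unique zero    = [] ∷ []
gen-unique (suc n) = concatMap-unique children (gen-unique n) (λ {T} _ → children-unique T)
  (λ _ _ → children-disjoint)

-- The enumeration PT

∈-boolLists : ∀ r → r ∈ boolLists (length r)
∈-boolLists []          = here refl
∈-boolLists (false ∷ r) = ∈-concatMap-intro _ (∈-boolLists r) (here refl)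
∈-boolLists (true  ∷ r) = ∈-concatMap-intro _ (∈-boolLists r) (there (here refl))

boolLists-length : ∀ m {r} → r ∈ boolLists m → length r ≡ m
boolLists-length zero    (here refl) = refl
boolLists-length (suc m) p with ∈-concatMap-elim _ (boolLists m) p
... | _ , q , here refl         = cong suc (boolLists-length m q)
... | _ , q , there (here refl) = cong suc (boolLists-length m q)

boolLists-unique : ∀ m → Unique (boolLists m)
boolLists-unique zero    = [] ∷ []
boolLists-unique (suc m) = concatMap-unique _ (boolLists-unique m)
  (λ _ → ((λ ()) ∷ []) ∷ ([] ∷ []))
  (λ { _ _ (here refl)         (here refl)         → refl
     ; _ _ (here refl)         (there (here ()))
     ; _ _ (there (here refl)) (here ())
     ; _ _ (there (here refl)) (there (here refl)) → refl })

module _ {A : Set} (xs : List A) where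
  ∈-listsOfLen : ∀ {l} → All (_∈ xs) l → l ∈ listsOfLen (length l) xs
  ∈-listsOfLen []       = here refl
  ∈-listsOfLen (p ∷ ps) = ∈-concatMap-intro _ (∈-listsOfLen ps) (∈-map⁺ _ p)

  listsOfLen-length : ∀ k {l} → l ∈ listsOfLen k xs → length l ≡ k
  listsOfLen-length zero    (here refl) = refl
  listsOfLen-length (suc k) p with ∈-concatMap-elim _ (listsOfLen k xs) p
  ... | l , q , r with _ , _ , refl ← ∈-map⁻ (_∷ l) r = cong suc (listsOfLen-length k q)

  listsOfLen-unique : Unique xs → ∀ k → Unique (listsOfLen k xs)
  listsOfLen-unique u zero    = [] ∷ []
  listsOfLen-unique u (suc k) = concatMap-unique _ (listsOfLen-unique u k)
    (λ _ → Uniq.map⁺ ∷-injectiveˡ u) same-tail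
    where
    same-tail : ∀ {l l′ z} → l ∈ listsOfLen k xs → l′ ∈ listsOfLen k xs →
      z ∈ map (_∷ l) xs → z ∈ map (_∷ l′) xs → l ≡ l′
    same-tail {l} {l′} _ _ p q with ∈-map⁻ (_∷ l) p | ∈-map⁻ (_∷ l′) q
    ... | _ , _ , refl | _ , _ , refl = refl

candidates-unique : ∀ n → Unique (candidates n)
candidates-unique n = concatMap-unique _ (Uniq.upTo⁺ (suc n))
  (λ {k} _ → listsOfLen-unique rows rows-unique k)
  (λ {k} {k′} _ _ p q → trans (sym (listsOfLen-length rows k p)) (listsOfLen-length rows k′ q))
  where
  rows = concatMap boolLists (upTo (suc n))
  rows-unique : Unique rows
  rows-unique = concatMap-unique boolLists (Uniq.upTo⁺ (suc n)) (λ {m} _ → boolLists-unique m)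
    (λ {m} {m′} _ _ p q → trans (sym (boolLists-length m p)) (boolLists-length m′ q))

ferrers-rows-≤ : ∀ r T → ferrersB (r ∷ T) ≡ true → All (λ s → length s ≤ length r) (r ∷ T)
ferrers-rows-≤ r []      fer = ℕₚ.≤-refl ∷ []
ferrers-rows-≤ r (s ∷ T) fer with ∧-true {length s ≤ᵇ length r} fer
... | s≤r , fer′ = ℕₚ.≤-refl ∷ All.map (λ p → ℕₚ.≤-trans p (≤ᵇ-≤ (length s) (length r) s≤r)) (ferrers-rows-≤ s T fer′)

-- The number of rows and the length of the first row add up to `tabLength T`, so n bounds both; the
-- Ferrers condition extends the bound to all rows.
∈-candidates : ∀ n T → ferrersB T ≡ true → tabLength T ≤ n → T ∈ candidates n
∈-candidates n T fer len≤n = ∈-concatMap-intro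
  (λ k → listsOfLen k (concatMap boolLists (upTo (suc n)))) (∈-upTo⁺ (s≤s (ℕₚ.m+n≤o⇒m≤o (numRows T) len≤n)))
  (∈-listsOfLen _ (All.map row (bounded T fer)))
  where
  bounded : ∀ T → ferrersB T ≡ true → All (λ s → length s ≤ numCols T) T
  bounded []      _   = []
  bounded (r ∷ T) fer = ferrers-rows-≤ r T fer
  row : ∀ {s} → length s ≤ numCols T → s ∈ concatMap boolLists (upTo (suc n))
  row {s} p = ∈-concatMap-intro boolLists
    (∈-upTo⁺ (s≤s (ℕₚ.≤-trans p (ℕₚ.m+n≤o⇒n≤o (numRows T) len≤n)))) (∈-boolLists s)

-- Two lists without repetition and with the same members are permutations of each other, which is
-- all that a sum requires. The index shifts because `gen` starts from length 1.
PT↭gen : ∀ n → PT (suc n) ↭ gen n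
PT↭gen n = ∼bag⇒↭ (unique∧set⇒bag (Uniq.filter⁺ P? (candidates-unique (suc n))) (gen-unique n)
  (mk⇔ to from))
  where
  inPT : Tableau → Bool
  inPT T = isPT T ∧ (tabLength T ≡ᵇ suc n)
  P? = 𝔹.T? ∘ inPT
  to : ∀ {T} → T ∈ PT (suc n) → T ∈ gen n
  to {T} p with ∧-true {isPT T} (Equivalence.to 𝔹ₚ.T-≡ (proj₂ (∈-filter⁻ P? {xs = candidates (suc n)} p)))
  ... | pt , len = gen-complete n T pt (ℕₚ.≡ᵇ⇒≡ _ _ (Equivalence.from 𝔹ₚ.T-≡ len))
  from : ∀ {T} → T ∈ gen n → T ∈ PT (suc n)
  from {T} p = ∈-filter⁺ P? (∈-candidates (suc n) T (fer G) (ℕₚ.≤-reflexive (len G)))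
    (Equivalence.from 𝔹ₚ.T-≡ (true-∧ (pt G) (Equivalence.to 𝔹ₚ.T-≡ (ℕₚ.≡⇒≡ᵇ _ _ (len G)))))
    where G = gen-good n p

-- Weights

word : Tableau → Word
word T = toWord (stateOf T)

word-addRow : ∀ {n T} → Good n T → word (T ∷ʳ []) ≡ word T ▷R
word-addRow {n} {[]}    G = ⊥-elim (T≢[] G refl)
word-addRow {n} {r ∷ T} G = trans (cong toWord (AddRow.stateOf-addRow r T))
  (foldl-∷ʳ addRow (R₀ ▷C^ topCount (r ∷ T) 0) (true , 0) (applyUpTo _ (length T)))

module Walks (R : CommutativeRing 0ℓ 0ℓ) where
  open CommutativeRing R using (Carrier; _≈_; +-cong; +-identityʳ; reflexive)
    renaming (trans to ≈-trans)
  open Sums R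
  open StateSums R

  Σ-children : ∀ (f : Word → Carrier) {n T} → Good n T →
    Σ[ f ∘ word ] (children T) ≈ Σ[ f ] (step (word T))
  Σ-children f {n} {[]}      G = ⊥-elim (T≢[] G refl)
  Σ-children f {n} {T@(r ∷ T₀)} G = +-cong (reflexive (cong f (word-addRow G)))
    (≈-trans (Σ-map (f ∘ word) (_⊲ T) (newCols T))
      (≈-trans (Σ-cong (newCols T) (λ {col} col∈ →
           let l , v , _ = ∈-newCols⁻ T col∈ in
           reflexive (cong (f ∘ toWord) (AddCol.stateOf-⊲ col T l (T≢[] G) (fer G) v))))
        (top-unrestricted (unrR-top T))))
    where
    s = applyUpTo (λ i → unrR T (suc i) , topCount T (suc i)) (numRows T₀)
    -- `unrR T 0` does not reduce to `true`; generalising it to `u` allows the equation to be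
    -- matched with `refl`.
    top-unrestricted : ∀ {u} → u ≡ true →
      Σ[ (λ col → f (toWord (insertCol col ((u , topCount T 0) ∷ s)))) ] (nonzeroCols (u ∷ map proj₁ s))
        ≈ Σ[ f ] (ins (toWord ((u , topCount T 0) ∷ s)))
    top-unrestricted refl = Σ-insertCol-toWord f (topCount T 0) (All.tail (consistent G))

  module _ (x y : Carrier) where
    open Moments R x y using (walk)

    -- `gen` adds its steps at the end, while `walk` unfolds its first step. The parameter i, the
    -- number of steps still to be taken after `gen n`, reconciles the two.
    Σ-gen : ∀ n i → Σ[ walk i ∘ word ] (gen n) ≈ walk (n + i) R₀
    Σ-gen zero    i = +-identityʳ _
    Σ-gen (suc n) i = ≈-trans (Σ-concatMap (walk i ∘ word) children (gen n))
      (≈-trans (Σ-cong (gen n) (λ T∈ → Σ-children (walk i) (gen-good n T∈)))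
        (≈-trans (Σ-gen n (suc i)) (reflexive (cong (λ k → walk k R₀) (ℕₚ.+-suc n i)))))

open CommSemi ℕₚ.+-commutativeSemigroup using (x∙yz≈yx∙z)

g₀-▷C^ : ∀ w {a b} c → M.g 0 w ≃ monoP a b → M.g 0 (w ▷C^ c) ≃ monoP a (c + b)
g₀-▷C^ w         zero    p = p
g₀-▷C^ w {a} {b} (suc c) p = P.trans {_} {YP *P monoP a (c + b)}
  (P.*-congˡ {YP} {M.g 0 (w ▷C^ c)} {monoP a (c + b)} (g₀-▷C^ w c p)) (mk≃ (YP*mono a (c + b)))

g₀-foldl : ∀ s w {a b} → M.g 0 w ≃ monoP a b → M.g 0 (foldl addRow w s) ≃ monoP (trues s + a) (sumC s + b)
g₀-foldl []                w p = p
g₀-foldl ((false , c) ∷ s) w {a} {b} p =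
  subst (λ k → M.g 0 (foldl addRow (w ▷C^ c) s) ≃ monoP (trues s + a) k) (x∙yz≈yx∙z (sumC s) c b)
    (g₀-foldl s (w ▷C^ c) (g₀-▷C^ w c p))
g₀-foldl ((true , c) ∷ s)  w {a} {b} p =
  subst (M.g 0 (foldl addRow ((w ▷R) ▷C^ c) s) ≃_) (cong₂ monoP (ℕₚ.+-suc (trues s) a) (x∙yz≈yx∙z (sumC s) c b))
    (g₀-foldl s ((w ▷R) ▷C^ c) (g₀-▷C^ (w ▷R) c
      (P.trans {_} {XP *P monoP a b} (P.*-congˡ {XP} {M.g 0 w} {monoP a b} p) (mk≃ (XP*mono a b)))))

-- `R₀` has weight 1, so the top row, always unrestricted, contributes no X. This is the -1 in the
-- exponent of X.
g₀-toWord : ∀ c s → M.g 0 (toWord ((true , c) ∷ s)) ≃ monoP (trues s) (c + sumC s)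
g₀-toWord c s = subst (M.g 0 (toWord ((true , c) ∷ s)) ≃_)
  (cong₂ monoP (ℕₚ.+-identityʳ (trues s)) (trans (cong (λ e → sumC s + e) (ℕₚ.+-identityʳ c)) (ℕₚ.+-comm (sumC s) c)))
  (g₀-foldl s (R₀ ▷C^ c) (g₀-▷C^ R₀ c (P.refl {1P})))

weight : Tableau → Poly2
weight T = monoP (urr T ∸ 1) (urc T)

weight≃g₀ : ∀ {n T} → Good n T → weight T ≃ M.g 0 (word T)
weight≃g₀ {n} {[]}          G = ⊥-elim (T≢[] G refl)
weight≃g₀ {n} {T@(r ∷ T₀)} G = P.sym {M.g 0 (word T)} {weight T}
  (subst (M.g 0 (word T) ≃_)
    (cong₂ (λ a b → monoP (a ∸ 1) b) (sym (urr≡trues T)) (sym (urc≡sumC T (pt G))))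
    (top-unrestricted (unrR-top T)))
  where
  s = applyUpTo (λ i → unrR T (suc i) , topCount T (suc i)) (numRows T₀)
  top-unrestricted : ∀ {u} → u ≡ true → M.g 0 (toWord ((u , topCount T 0) ∷ s))
    ≃ monoP (trues ((u , topCount T 0) ∷ s) ∸ 1) (sumC ((u , topCount T 0) ∷ s))
  top-unrestricted refl = g₀-toWord (topCount T 0) s

theorem4p1 : (n : ℕ) → μ n ≈P ptSum (suc n)
theorem4p1 n = coeff (begin
  μ n                          ≈⟨ μ≃walk n ⟩
  M.walk n R₀                  ≡⟨ cong (λ k → M.walk k R₀) (sym (ℕₚ.+-identityʳ n)) ⟩
  M.walk (n + 0) R₀            ≈⟨ P.sym {Σ[ M.g 0 ∘ word ] (gen n)} {M.walk (n + 0) R₀} (Walks.Σ-gen poly2Ring XP YP n 0) ⟩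
  Σ[ M.g 0 ∘ word ] (gen n)    ≈⟨ Σ-cong (gen n) (λ {T} T∈ → P.sym {weight T} {M.g 0 (word T)} (weight≃g₀ (gen-good n T∈))) ⟩
  Σ[ weight ] (gen n)          ≈⟨ P.sym {Σ[ weight ] (PT (suc n))} {Σ[ weight ] (gen n)} (Σ-↭ weight (PT↭gen n)) ⟩
  ptSum (suc n)                ∎)
  where
  open Sums poly2Ring
  open SetoidReasoning P.setoid
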